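{- For every $k\ge 1$ there is a constant $c_k>0$ such that the following holds. Let $P_1,\dots,P_k$ be oriented paths, each with at least one edge, and write $l_i=l(P_i)$ and $L_i=|P_i|-1$. Then $$l_1\cdots l_k\cdot \max_{i\in[k]}\frac{L_i}{l_i}\;\le\;\mathrm{RT}(P_1,\dots,P_k)\;\le\; c_k\cdot l_1\cdots l_k\cdot\max_{i\in[k]}\frac{L_i}{l_i}.$$
   Context: An oriented path is a path whose edges may be oriented arbitrarily, with no bidirected edges; $|P|$ is its number of vertices. For an oriented path $P$, $l(P)$ is the length (number of edges) of the longest directed subpath of $P$. A tournament is an oriented graph with exactly one edge between every pair of distinct vertices. $\mathrm{RT}(G_1,\dots,G_k)$ is the least $N$ such that in every tournament on $N$ vertices whose edges are coloured with colours $1,\dots,k$ there is an $i$ such that there is a copy (subgraph isomorphic as a directed graph) of $G_i$ all of whose edges have colour $i$. -}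

module Defs where

open import Data.Bool.Base using (Bool; T)
open import Data.Fin.Base using (Fin; zero; suc; inject₁)
open import Data.Integer.Base using (+_)
open import Data.List.Base
  using (List; []; _∷_; length; lookup; map; filter; concatMap; inits; tails; tabulate; foldr)
open import Data.List.Extrema.Nat using (max; v≤max⁺)
open import Data.List.Membership.Propositional using (_∈_)
open import Data.List.Membership.Propositional.Properties using (∈-filter⁺; ∈-map⁺)
open import Data.List.Relation.Unary.All using (All; []; _∷_; all?)
open import Data.List.Relation.Unary.Any as Any using (here; there)
open import Data.Nat.Base using (ℕ; suc; _∸_; _≤_; NonZero; >-nonZero; s≤s)
open import Data.Nat.ListAction using (product)
open import Data.Nat.Properties using (≤-reflexive)
open import Data.Product.Base using (Σ; ∃; _×_; _,_)
open import Data.Rational.Base as ℚ using (ℚ; 0ℚ)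
open import Data.Sum.Base using (_⊎_; inj₁; inj₂)
open import Function.Definitions using (Injective)
open import Level using (0ℓ)
open import Relation.Binary.Core using (Rel)
open import Relation.Binary.Definitions using (Trichotomous; DecidableEquality)
open import Relation.Binary.PropositionalEquality.Core using (_≡_; refl)
open import Relation.Nullary.Decidable using (Dec; yes; no; _⊎-dec_)

------------------------------------------------------------------------
-- Digraphs and copies

record Digraph : Set₁ where
  field
    order : ℕ
    Arc   : Rel (Fin order) 0ℓ

open Digraph public

-- A copy of G in H is a not necessarily induced subgraph of H isomorphic to G.
Copy : Digraph → Digraph → Set
Copy G H =
  Σ (Fin (order G) → Fin (order H)) λ f →
    Injective _≡_ _≡_ f × (∀ {u v} → Arc G u v → Arc H (f u) (f v))

------------------------------------------------------------------------
-- Oriented paths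

data Direction : Set where
  forward backward : Direction

_≟_ : DecidableEquality Direction
forward  ≟ forward  = yes refl
forward  ≟ backward = no λ ()
backward ≟ forward  = no λ ()
backward ≟ backward = yes refl

-- The path on vertices 0, 1, …, n is given by the list of the directions of
-- its n edges: the e-th edge goes from e to e + 1 if it is forward, and from
-- e + 1 to e if it is backward.
OrientedPath : Set
OrientedPath = List Direction

∣_∣ : OrientedPath → ℕ
∣ P ∣ = suc (length P)

data PathArc (P : OrientedPath) : Rel (Fin ∣ P ∣) 0ℓ where
  forward  : ∀ e → lookup P e ≡ forward  → PathArc P (inject₁ e) (suc e)
  backward : ∀ e → lookup P e ≡ backward → PathArc P (suc e) (inject₁ e)

pathDigraph : OrientedPath → Digraph
pathDigraph P = record { order = ∣ P ∣ ; Arc = PathArc P }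

-- The subpaths of P are the contiguous pieces of its list of edges.
subpaths : OrientedPath → List OrientedPath
subpaths P = concatMap inits (tails P)

Directed : OrientedPath → Set
Directed P = All (_≡ forward) P ⊎ All (_≡ backward) P

directed? : ∀ P → Dec (Directed P)
directed? P = all? (_≟ forward) P ⊎-dec all? (_≟ backward) P

-- The default value 0 of the maximum is the length of the empty subpath.
l : OrientedPath → ℕ
l P = max 0 (map length (filter directed? (subpaths P)))

L : OrientedPath → ℕ
L P = ∣ P ∣ ∸ 1

singleEdge-directed : ∀ d → Directed (d ∷ [])
singleEdge-directed forward  = inj₁ (refl ∷ [])
singleEdge-directed backward = inj₂ (refl ∷ [])

l-nonZero : ∀ P → 1 ≤ L P → NonZero (l P)
l-nonZero (d ∷ P) _ = >-nonZero
  (v≤max⁺ 0 _ (inj₂ (Any.map ≤-reflexive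
    (∈-map⁺ length (∈-filter⁺ directed? [d]∈subpaths (singleEdge-directed d))))))
  where
  [d]∈subpaths : d ∷ [] ∈ subpaths (d ∷ P)
  [d]∈subpaths = there (here refl)

------------------------------------------------------------------------
-- Coloured tournaments and Ramsey numbers

-- Trichotomy says that there are no loops and that exactly one of u → v and
-- v → u is an edge whenever u ≢ v.
record Tournament (N : ℕ) : Set where
  field
    edge       : Fin N → Fin N → Bool
    tournament : Trichotomous _≡_ (λ u v → T (edge u v))

open Tournament public

-- The colour of a pair (u , v) is only used when u → v is an edge.
Colouring : ℕ → ℕ → Set
Colouring k N = Fin N → Fin N → Fin k

colourClass : ∀ {k N} → Tournament N → Colouring k N → Fin k → Digraph
colourClass {N = N} 𝒯 χ i = record
  { order = N
  ; Arc   = λ u v → T (edge 𝒯 u v) × χ u v ≡ i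
  }

Unavoidable : ∀ {k} → (Fin k → Digraph) → ℕ → Set
Unavoidable {k} G N =
  (𝒯 : Tournament N) (χ : Colouring k N) →
  ∃ λ (i : Fin k) → Copy (G i) (colourClass 𝒯 χ i)

-- IsRT G N says that RT(G₁, …, Gₖ) exists and equals N.
IsRT : ∀ {k} → (Fin k → Digraph) → ℕ → Set
IsRT G N = Unavoidable G N × (∀ M → Unavoidable G M → N ≤ M)

------------------------------------------------------------------------
-- The quantity l₁ ⋯ lₖ · max Lᵢ / lᵢ

fromℕ : ℕ → ℚ
fromℕ n = + n ℚ./ 1

ratio : (P : OrientedPath) → 1 ≤ L P → ℚ
ratio P P≥1 = (+ L P ℚ./ l P) {{l-nonZero P P≥1}}

-- The ratios are positive, so for k ≥ 1 the initial value 0 does not affect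
-- the maximum.
bound : ∀ {k} (P : Fin k → OrientedPath) → (∀ i → 1 ≤ L (P i)) → ℚ
bound P P≥1 =
  fromℕ (product (tabulate λ i → l (P i)))
    ℚ.* foldr ℚ._⊔_ 0ℚ (tabulate λ i → ratio (P i) (P≥1 i))

{-# OPTIONS --safe #-}
-- Lower bound: let colour j attain the maximum of Lᵢ / lᵢ. Take a transitive
-- tournament cut into intervals of Lⱼ vertices, colour j inside the intervals,
-- and number the intervals with one digit base lᵢ for each i ≢ j; an edge between
-- intervals is coloured by a digit that increases along it.
--
-- Upper bound, by induction on the number of colours: some colour c has many
-- edges, so there are sets X and Z such that in colour c every vertex of X has
-- many out-neighbours in Z and every vertex of Z has many in-neighbours in X.
-- Embed P_c greedily, vertex t in X if the edge t is forward and in Z otherwise.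
-- At a turn of P_c, the whole next run is taken inside the unused part of the
-- neighbourhood of the current vertex. By the Gallai–Roy theorem this fails only
-- if that part contains a large set without edges of colour c, in which the
-- induction hypothesis applies.

module Submission where

open import Defs
open import Data.Fin.Base using (Fin)
open import Data.Nat.Base using (ℕ; _≤_)
open import Data.Product.Base using (∃; _×_)
open import Data.Rational.Base as ℚ using (ℚ; 0ℚ)

-- A colour with many edges need not contain a directed path with two edges: all its edges may go
-- from `X` to `Z`. Degrees can thus serve only where the path turns, and the runs need another
-- source. Setting a run aside as a whole keeps the required degree at `L (P c) + a * l (P c)`. Used
-- vertices are subtracted once, and `a * l (P c)` is the price of a directed path when independent
-- sets stay below `a`. If `a` is the value for the remaining colours, their product of lengths
-- gains exactly the factor `l (P c)`, while `L (P c)` is at most `D * l (P c)`. So each colour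
-- costs only a constant factor, with the same `D` throughout. Which colour is popular cannot be
-- chosen, so the induction claims the bound for every list of colours. The ratio is rounded to a
-- natural number `D`, which costs a factor 2. As the Ramsey number must be a least number and the
-- proof is constructive, unavoidability is decided by exhaustive search.

-- Double counting of arcs and dense cores

module Counting where

  open import Data.Bool.Base using (true; false; if_then_else_)

  open import Data.Empty using (⊥-elim)
  open import Data.List.Base using (List; []; _∷_; length; filter)
  open import Data.List.Membership.Propositional using (_∈_)
  open import Data.List.Relation.Binary.Sublist.Propositional using (_⊆_; ⊆-refl; ⊆-trans)
  open import Data.List.Relation.Binary.Sublist.Propositional.Properties using (filter-⊆)
  open import Data.List.Relation.Unary.Any using (here; there)
  open import Data.List.Relation.Unary.All using (All; []; _∷_; all?)
  open import Data.List.Relation.Unary.All.Properties using (¬All⇒Any¬)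
  open import Data.List.Properties using (filter-notAll)
  open import Data.Nat.Base
  open import Data.Nat.Properties
  open import Data.Nat.Tactic.RingSolver using (solve-∀)
  open import Data.Product.Base using (∃₂; _×_; _,_)
  open import Relation.Binary.Core using (Rel)
  open import Relation.Binary.Definitions using (Decidable)
  open import Relation.Binary.PropositionalEquality
  open import Relation.Nullary using (yes; no; ¬_; does)
  open import Relation.Unary using (Pred) renaming (Decidable to Decidable₁)
  open import Level using (0ℓ)

  private
    variable
      A B : Set

  ∑ : List A → (A → ℕ) → ℕ
  ∑ []       f = 0
  ∑ (x ∷ xs) f = f x + ∑ xs f

  ∑-cong : ∀ (xs : List A) {f g : A → ℕ} → (∀ x → f x ≡ g x) → ∑ xs f ≡ ∑ xs g
  ∑-cong []       f≗g = refl
  ∑-cong (x ∷ xs) f≗g = cong₂ _+_ (f≗g x) (∑-cong xs f≗g)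

  ∑-mono-≤ : ∀ (xs : List A) {f g : A → ℕ} → (∀ {x} → x ∈ xs → f x ≤ g x) → ∑ xs f ≤ ∑ xs g
  ∑-mono-≤ []       f≤g = z≤n
  ∑-mono-≤ (x ∷ xs) f≤g = +-mono-≤ (f≤g (here refl)) (∑-mono-≤ xs (λ x∈xs → f≤g (there x∈xs)))

  ∑-const : ∀ (xs : List A) n → ∑ xs (λ _ → n) ≡ length xs * n
  ∑-const []       n = refl
  ∑-const (x ∷ xs) n = cong (n +_) (∑-const xs n)

  ∑-distrib-+ : ∀ (xs : List A) (f g : A → ℕ) → ∑ xs (λ x → f x + g x) ≡ ∑ xs f + ∑ xs g
  ∑-distrib-+ []       f g = refl
  ∑-distrib-+ (x ∷ xs) f g rewrite ∑-distrib-+ xs f g = interchange (f x) (g x) (∑ xs f) (∑ xs g)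
    where
    interchange : ∀ a b c d → a + b + (c + d) ≡ a + c + (b + d)
    interchange = solve-∀

  ∑-comm : ∀ (xs : List A) (ys : List B) (f : A → B → ℕ) →
           ∑ xs (λ x → ∑ ys (f x)) ≡ ∑ ys (λ y → ∑ xs (λ x → f x y))
  ∑-comm []       ys f = sym (trans (∑-const ys 0) (*-zeroʳ (length ys)))
  ∑-comm (x ∷ xs) ys f rewrite ∑-comm xs ys f = sym (∑-distrib-+ ys (f x) _)

  count : {P : Pred A 0ℓ} → Decidable₁ P → List A → ℕ
  count P? xs = ∑ xs (λ x → if does (P? x) then 1 else 0)

  count≡length-filter : {P : Pred A 0ℓ} (P? : Decidable₁ P) (xs : List A) →
                        count P? xs ≡ length (filter P? xs)
  count≡length-filter P? []       = refl
  count≡length-filter P? (x ∷ xs) with does (P? x)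
  ... | true  = cong suc (count≡length-filter P? xs)
  ... | false = count≡length-filter P? xs

  module _ {E : Rel A 0ℓ} (E? : Decidable E) where

    outdegree indegree : List A → A → ℕ
    outdegree Z x = count (E? x) Z
    indegree  X z = count (λ x → E? x z) X

    arcs : List A → List A → ℕ
    arcs X Z = ∑ X (outdegree Z)

    arcs≡∑indegree : ∀ X Z → arcs X Z ≡ ∑ Z (indegree X)
    arcs≡∑indegree X Z = ∑-comm X Z _

  -- Each dropped element takes at most `m` from the sum and exactly `m` from `m` times the length.
  -- Both sides are completed by addition because subtraction on ℕ truncates.
  ∑-filter : ∀ m (f : A → ℕ) {P : Pred A 0ℓ} (P? : Decidable₁ P) → (∀ x → ¬ P x → f x ≤ m) →
             ∀ xs → ∑ xs f + m * length (filter P? xs) ≤ ∑ (filter P? xs) f + m * length xs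
  ∑-filter m f P? small []       = ≤-refl
  ∑-filter m f P? small (x ∷ xs) with ∑-filter m f P? small xs | P? x
  ... | ih | yes _  = begin
    f x + s + m * suc k    ≡⟨ shuffle (f x) s m k ⟩
    f x + m + (s + m * k)  ≤⟨ +-monoʳ-≤ (f x + m) ih ⟩
    f x + m + (s′ + m * n) ≡⟨ shuffle (f x) s′ m n ⟨
    f x + s′ + m * suc n   ∎
    where
    open ≤-Reasoning
    s  = ∑ xs f
    s′ = ∑ (filter P? xs) f
    k  = length (filter P? xs)
    n  = length xs
    shuffle : ∀ a b c d → a + b + c * suc d ≡ a + c + (b + c * d)
    shuffle = solve-∀
  ... | ih | no ¬px = begin
    f x + s + m * k     ≡⟨ +-assoc (f x) s _ ⟩
    f x + (s + m * k)   ≤⟨ +-mono-≤ (small x ¬px) ih ⟩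
    m + (s′ + m * n)    ≡⟨ shuffle m s′ n ⟩
    s′ + m * suc n      ∎
    where
    open ≤-Reasoning
    s  = ∑ xs f
    s′ = ∑ (filter P? xs) f
    k  = length (filter P? xs)
    n  = length xs
    shuffle : ∀ a b c → a + (b + a * c) ≡ b + a * suc c
    shuffle = solve-∀

  -- Strict density survives pruning: a dropped entry lowers the left side by `m` and the right side
  -- by at most `m`. `n` is the size of the other side of the pair, which stays fixed.
  ∑-filter-< : ∀ m n (f : A → ℕ) xs → m * (length xs + n) < ∑ xs f →
               m * (length (filter (λ x → m ≤? f x) xs) + n) <
               ∑ (filter (λ x → m ≤? f x) xs) f
  ∑-filter-< m n f xs dense = +-cancelʳ-< (m * length xs) _ _ (begin-strict
    m * (k + n) + m * length xs    ≡⟨ shuffle m k n (length xs) ⟩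
    m * (length xs + n) + m * k    <⟨ +-monoˡ-< (m * k) dense ⟩
    ∑ xs f + m * k                 ≤⟨ ∑-filter m f (λ x → m ≤? f x) (λ x m≰fx → <⇒≤ (≰⇒> m≰fx)) xs ⟩
    ∑ (filter (λ x → m ≤? f x) xs) f + m * length xs ∎)
    where
    open ≤-Reasoning
    k = length (filter (λ x → m ≤? f x) xs)
    shuffle : ∀ m k n l → m * (k + n) + m * l ≡ m * (l + n) + m * k
    shuffle = solve-∀

  module _ {E : Rel A 0ℓ} (E? : Decidable E) where

    -- The two sides may overlap, since both will be cut out of one vertex set. Nonemptiness of `X′`
    -- passes to `Z′` through the degrees as soon as `m` is positive.
    DenseCore : ℕ → List A → List A → Set
    DenseCore m X Z = ∃₂ λ X′ Z′ → X′ ⊆ X × Z′ ⊆ Z × 0 < length X′ ×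
      All (λ x → m ≤ outdegree E? Z′ x) X′ × All (λ z → m ≤ indegree E? X′ z) Z′

    private
      -- All vertices of low degree on one side go at once, and the density inequality is kept. It
      -- also prevents running out of vertices, since then there would be no arcs. `n` bounds the
      -- total size and makes the recursion structural.
      core : ∀ m n X Z → length X + length Z ≤ n → m * (length X + length Z) < arcs E? X Z →
             DenseCore m X Z
      core m n X Z size≤n dense
        with all? (λ x → m ≤? outdegree E? Z x) X | all? (λ z → m ≤? indegree E? X z) Z
      core m n []        Z _ () | yes _ | yes _
      core m n X@(_ ∷ _) Z _ _  | yes out | yes inn = X , Z , ⊆-refl , ⊆-refl , z<s , out , inn
      core m zero X Z size≤0 dense | no ¬out | _ with X
      ... | []    = ⊥-elim (¬out [])
      ... | _ ∷ _ with () ← size≤0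
      core m zero X Z size≤0 dense | yes _ | no ¬inn with Z
      ... | []    = ⊥-elim (¬inn [])
      ... | _ ∷ _ with () ← subst (_≤ 0) (+-comm (length X) _) size≤0
      core m (suc n) X Z size≤n dense | no ¬out | _ =
        let X₁ = filter (λ x → m ≤? outdegree E? Z x) X
            smaller = filter-notAll (λ x → m ≤? outdegree E? Z x) X (¬All⇒Any¬ (λ x → m ≤? outdegree E? Z x) X ¬out)
            X′ , Z′ , X′⊆ , Z′⊆ , rest =
              core m n X₁ Z (≤-pred (≤-trans (+-monoˡ-< (length Z) smaller) size≤n))
                (∑-filter-< m (length Z) (outdegree E? Z) X dense)
        in X′ , Z′ , ⊆-trans X′⊆ (filter-⊆ _ X) , Z′⊆ , rest
      core m (suc n) X Z size≤n dense | yes _ | no ¬inn =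
        let P? = λ z → m ≤? indegree E? X z
            Z₁ = filter P? Z
            smaller = filter-notAll P? Z (¬All⇒Any¬ P? Z ¬inn)
            -- Deletions in `Z` are measured by in-degrees, so the density is rewritten as a sum
            -- over `Z`; double counting brings it back for the recursive call.
            dense′ = ∑-filter-< m (length X) (indegree E? X) Z
              (subst₂ _<_ (cong (m *_) (+-comm (length X) _)) (arcs≡∑indegree E? X Z) dense)
            X′ , Z′ , X′⊆ , Z′⊆ , rest =
              core m n X Z₁ (≤-pred (≤-trans (+-monoʳ-< (length X) smaller) size≤n))
                (subst₂ _<_ (cong (m *_) (+-comm _ (length X))) (sym (arcs≡∑indegree E? X Z₁)) dense′)
        in X′ , Z′ , X′⊆ , ⊆-trans Z′⊆ (filter-⊆ _ Z) , rest

    denseCore : ∀ m X Z → m * (length X + length Z) < arcs E? X Z → DenseCore m X Z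
    denseCore m X Z = core m _ X Z ≤-refl

-- The Gallai-Roy theorem for arbitrary digraphs

module LongPaths where

  open import Data.Fin.Base using (Fin; zero; suc)
  open import Data.Fin.Properties using (any?)
  open import Data.Empty using (⊥; ⊥-elim)
  open import Data.Unit.Base using (⊤; tt)
  open import Data.List.Base using (List; []; _∷_; length; lookup; map; filter; allFin)
  open import Data.List.Properties using (length-map; length-tabulate)
  open import Data.List.Membership.Propositional using (_∈_; _∉_)
  open import Data.List.Relation.Unary.All as All using (All; []; _∷_)
  import Data.List.Relation.Unary.All.Properties as All
  open import Data.List.Relation.Unary.AllPairs using (AllPairs; []; _∷_)
  import Data.List.Relation.Unary.AllPairs as AllPairs
  open import Data.List.Relation.Unary.Linked as Linked using (Linked; [-]; _∷_)
  import Data.List.Relation.Unary.Linked.Properties as Linked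
  open import Data.List.Relation.Unary.Unique.Propositional using (Unique)
  import Data.List.Relation.Unary.Unique.Propositional.Properties as Unique
  open import Data.List.Membership.Propositional.Properties using (∈-lookup; ∈-filter⁻; ∈-map⁻)
  open import Data.Nat.Base as ℕ using (ℕ; zero; suc; _+_; _*_; _≤_)
  open import Data.Nat.Properties
    using (*-zeroʳ; +-identityʳ; +-cancelʳ-<; +-comm; *-suc; +-monoʳ-≤; <⇒≤; ≰⇒>; +-suc; _≤?_; module ≤-Reasoning)
  open import Data.Product.Base using (∃; ∃₂; _×_; _,_; proj₁; proj₂)
  open import Data.Sum.Base using (_⊎_; inj₁; inj₂)
  open import Relation.Binary.Core using (Rel)
  open import Relation.Binary.Definitions using (Decidable; Transitive)
  open import Relation.Binary.Construct.Closure.Transitive using (TransClosure; [_]; _∷_; _∷ʳ_; _++_)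
  open import Relation.Binary.PropositionalEquality hiding ([_])
  open import Relation.Nullary using (yes; no; ¬_; ¬?; _×-dec_; _⊎-dec_)
  open import Relation.Unary using (Pred) renaming (Decidable to Decidable₁)
  open import Level using (0ℓ)

  private
    variable
      A B : Set

  module _ {_R_ : Rel A 0ℓ} {_S_ : Rel B 0ℓ} {f : A → B} (g : ∀ {x y} → x R y → f x S f y) where
    ⟨_⟩⁺ : ∀ {x y} → TransClosure _R_ x y → TransClosure _S_ (f x) (f y)
    ⟨ [ r ] ⟩⁺   = [ g r ]
    ⟨ r ∷ rs ⟩⁺ = g r ∷ ⟨ rs ⟩⁺

  -- A linear extension of _<_ is an ordering of the vertices in which every arc going
  -- back closes a directed cycle with arcs going forward; the levels of _<_ are then
  -- the colour classes in the Gallai–Roy theorem, and this also covers digraphs with cycles.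
  record PathOrder {n} (E : Rel (Fin n) 0ℓ) : Set₁ where
    infix 4 _<_ _<?_
    field
      _<_       : Rel (Fin n) 0ℓ
      _<?_      : Decidable _<_
      <-trans   : Transitive _<_
      <-irrefl  : ∀ {u} → ¬ u < u
      <⇒path    : ∀ {u v} → u < v → TransClosure (λ a b → a < b × E a b) u v
      arc⇒<⊎>   : ∀ {u v} → u ≢ v → E u v → u < v ⊎ v < u

  -- The new vertex zero is put above every vertex with a path to it, and below the
  -- other vertices reachable from it.
  module Insert {n} {E : Rel (Fin (suc n)) 0ℓ} (E? : Decidable E)
                (O : PathOrder (λ u v → E (suc u) (suc v))) where
    open PathOrder O

    Below : Fin n → Set
    Below a = E (suc a) zero ⊎ ∃ λ b → a < b × E (suc b) zero

    -- A vertex that also has a path to `zero` counts as below only, which keeps the new relation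
    -- irreflexive. The same exclusion for the intermediate `a` makes the arc from `zero` to it
    -- ascending.
    Above : Fin n → Set
    Above b = ¬ Below b × (E zero (suc b) ⊎ ∃ λ a → a < b × ¬ Below a × E zero (suc a))

    below? : Decidable₁ Below
    below? a = E? (suc a) zero ⊎-dec any? λ b → (a <? b) ×-dec E? (suc b) zero

    above? : Decidable₁ Above
    above? b = ¬? (below? b) ×-dec
      (E? zero (suc b) ⊎-dec any? λ a → (a <? b) ×-dec (¬? (below? a) ×-dec E? zero (suc a)))

    <-below : ∀ {a b} → a < b → Below b → Below a
    <-below a<b (inj₁ e)            = inj₂ (_ , a<b , e)
    <-below a<b (inj₂ (c , b<c , e)) = inj₂ (c , <-trans a<b b<c , e)

    above-< : ∀ {a b} → Above a → a < b → Above b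
    above-< (¬below , inj₁ e) a<b =
      (λ below → ¬below (<-below a<b below)) , inj₂ (_ , a<b , ¬below , e)
    above-< (¬below , inj₂ (c , c<a , ¬c , e)) a<b =
      (λ below → ¬below (<-below a<b below)) , inj₂ (c , <-trans c<a a<b , ¬c , e)

    infix 4 _<′_
    _<′_ : Rel (Fin (suc n)) 0ℓ
    zero  <′ zero  = ⊥
    zero  <′ suc b = Above b
    suc a <′ zero  = Below a
    suc a <′ suc b = a < b ⊎ (Below a × Above b)

    _<′?_ : Decidable _<′_
    zero  <′? zero  = no λ ()
    zero  <′? suc b = above? b
    suc a <′? zero  = below? a
    suc a <′? suc b = (a <? b) ⊎-dec (below? a ×-dec above? b)

    <′-trans : Transitive _<′_
    <′-trans {zero}  {suc _} {zero}  (¬b , _) b           = ¬b b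
    <′-trans {zero}  {suc _} {suc _} ab (inj₁ b<c)        = above-< ab b<c
    <′-trans {zero}  {suc _} {suc _} ab (inj₂ (_ , c))    = c
    <′-trans {suc _} {zero}  {suc _} a c                  = inj₂ (a , c)
    <′-trans {suc _} {suc _} {zero}  (inj₁ a<b) b         = <-below a<b b
    <′-trans {suc _} {suc _} {zero}  (inj₂ (a , _)) _     = a
    <′-trans {suc _} {suc _} {suc _} (inj₁ a<b) (inj₁ b<c)       = inj₁ (<-trans a<b b<c)
    <′-trans {suc _} {suc _} {suc _} (inj₁ a<b) (inj₂ (b , c))   = inj₂ (<-below a<b b , c)
    <′-trans {suc _} {suc _} {suc _} (inj₂ (a , b)) (inj₁ b<c)   = inj₂ (a , above-< b b<c)
    <′-trans {suc _} {suc _} {suc _} (inj₂ (a , _)) (inj₂ (_ , c)) = inj₂ (a , c)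

    <′-irrefl : ∀ {u} → ¬ u <′ u
    <′-irrefl {suc _} (inj₁ a<a)          = <-irrefl a<a
    <′-irrefl {suc _} (inj₂ (b , ¬b , _)) = ¬b b

    Arc′ : Rel (Fin (suc n)) 0ℓ
    Arc′ u v = u <′ v × E u v

    old : ∀ {a b} → a < b → TransClosure Arc′ (suc a) (suc b)
    old a<b = ⟨ (λ (u<v , e) → inj₁ u<v , e) ⟩⁺ (<⇒path a<b)

    below⇒path : ∀ {a} → Below a → TransClosure Arc′ (suc a) zero
    below⇒path b@(inj₁ e)           = [ b , e ]
    below⇒path (inj₂ (_ , a<c , e)) = old a<c ∷ʳ (inj₁ e , e)

    above⇒path : ∀ {b} → Above b → TransClosure Arc′ zero (suc b)
    above⇒path b@(_ , inj₁ e)                 = [ b , e ]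
    above⇒path (_ , inj₂ (_ , a<b , ¬a , e)) = ((¬a , inj₁ e) , e) ∷ old a<b

    <′⇒path : ∀ {u v} → u <′ v → TransClosure Arc′ u v
    <′⇒path {zero}  {suc _} b              = above⇒path b
    <′⇒path {suc _} {zero}  a              = below⇒path a
    <′⇒path {suc _} {suc _} (inj₁ a<b)     = old a<b
    <′⇒path {suc _} {suc _} (inj₂ (a , b)) = below⇒path a ++ above⇒path b

    arc⇒<′⊎>′ : ∀ {u v} → u ≢ v → E u v → u <′ v ⊎ v <′ u
    arc⇒<′⊎>′ {zero}  {zero}  u≢v e = ⊥-elim (u≢v refl)
    arc⇒<′⊎>′ {zero}  {suc b} u≢v e with below? b
    ... | yes below = inj₂ below
    ... | no ¬below = inj₁ (¬below , inj₁ e)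
    arc⇒<′⊎>′ {suc a} {zero}  u≢v e = inj₁ (inj₁ e)
    arc⇒<′⊎>′ {suc a} {suc b} u≢v e with arc⇒<⊎> (λ a≡b → u≢v (cong suc a≡b)) e
    ... | inj₁ a<b = inj₁ (inj₁ a<b)
    ... | inj₂ b<a = inj₂ (inj₁ b<a)

    insert : PathOrder E
    insert = record
      { _<_ = _<′_ ; _<?_ = _<′?_ ; <-trans = <′-trans ; <-irrefl = λ {u} → <′-irrefl {u}
      ; <⇒path = <′⇒path ; arc⇒<⊎> = arc⇒<′⊎>′ }

  pathOrder : ∀ {n} {E : Rel (Fin n) 0ℓ} → Decidable E → PathOrder E
  pathOrder {zero}  E? = record
    { _<_ = λ _ _ → ⊥ ; _<?_ = λ () ; <-trans = λ () ; <-irrefl = λ ()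
    ; <⇒path = λ () ; arc⇒<⊎> = λ {u} → ⊥-elim (no-vertex u) }
    where
    no-vertex : Fin 0 → ⊥
    no-vertex ()
  pathOrder {suc n} E? = Insert.insert E? (pathOrder (λ u v → E? (suc u) (suc v)))

  Independent : Rel A 0ℓ → List A → Set
  Independent E xs = ∀ {u v} → u ∈ xs → v ∈ xs → ¬ E u v

  length-filter-split : {P : Pred A 0ℓ} (P? : Decidable₁ P) (xs : List A) →
    length xs ≡ length (filter P? xs) + length (filter (λ x → ¬? (P? x)) xs)
  length-filter-split P? [] = refl
  length-filter-split P? (x ∷ xs) with P? x
  ... | yes _ = cong suc (length-filter-split P? xs)
  ... | no _  = trans (cong suc (length-filter-split P? xs)) (sym (+-suc _ _))

  module GallaiRoy {n} {E : Rel (Fin n) 0ℓ} (E? : Decidable E) (E-irrefl : ∀ {u} → ¬ E u u) where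
    open PathOrder (pathOrder E?)

    -- Height in the subdigraph of ascending arcs. The vertices with `Tall i` but not `Tall (suc i)`
    -- form colour class `i` of Gallai-Roy.
    Tall : ℕ → Pred (Fin n) 0ℓ
    Tall zero    u = ⊤
    Tall (suc i) u = ∃ λ v → (u < v × E u v) × Tall i v

    tall? : ∀ i → Decidable₁ (Tall i)
    tall? zero    u = yes tt
    tall? (suc i) u = any? λ v → ((u <? v) ×-dec E? u v) ×-dec tall? i v

    tall-pred : ∀ i {u} → Tall (suc i) u → Tall i u
    tall-pred zero    _             = tt
    tall-pred (suc i) (v , uv , tv) = v , uv , tall-pred i tv

    path-tall : ∀ i {u v} → TransClosure (λ a b → a < b × E a b) u v → Tall i v → Tall (suc i) u
    path-tall i [ uv ]    tv = _ , uv , tv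
    path-tall i (uw ∷ wv) tv = _ , uw , tall-pred i (path-tall i wv tv)

    -- Whichever way an arc goes, its ends are comparable, and `<⇒path` gives a path of ascending
    -- arcs from the lower end to the higher one. The lower end thus exceeds the common height.
    level-independent : ∀ i {u v} → Tall i u → ¬ Tall (suc i) u → Tall i v → ¬ Tall (suc i) v → ¬ E u v
    level-independent i {u} {v} tu ¬tu tv ¬tv e
      with arc⇒<⊎> (λ { refl → E-irrefl e }) e
    ... | inj₁ u<v = ¬tu (path-tall i (<⇒path u<v) tv)
    ... | inj₂ v<u = ¬tv (path-tall i (<⇒path v<u) tu)

    tall⇒path : ∀ i u → Tall i u → ∃ λ us → length us ≡ i × Linked (λ a b → a < b × E a b) (u ∷ us)
    tall⇒path zero    u _             = [] , refl , [-]
    tall⇒path (suc i) u (v , uv , tv) with vs , len , path ← tall⇒path i v tv =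
      v ∷ vs , cong suc len , uv ∷ path

    LongPath : ℕ → Set
    LongPath ℓ = ∃₂ λ u us → length us ≡ ℓ × Linked E (u ∷ us) × Unique (u ∷ us)

    LargeIndependent : ℕ → List (Fin n) → Set
    LargeIndependent a xs = ∃ λ ys → a ≤ length ys × Unique ys × Independent E ys

    -- Pigeonhole over `ℓ` consecutive heights starting from `i`: a level with at least `a` members
    -- is the independent set, and a smaller one is dropped at a cost below `a`. Once no level is
    -- left, any survivor starts a path of the full length.
    peel : ∀ a ℓ i xs → Unique xs → All (Tall i) xs → a * ℓ ℕ.< length xs →
           LargeIndependent a xs ⊎ ∃ (Tall (i + ℓ))
    peel a zero i [] _ _ large rewrite *-zeroʳ a with () ← large
    peel a zero i (x ∷ xs) _ (t ∷ _) _ = inj₂ (x , subst (λ j → Tall j x) (sym (+-identityʳ i)) t)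
    peel a (suc ℓ) i xs uniq tall large
      with a ≤? length (filter (λ x → ¬? (tall? (suc i) x)) xs)
    ... | yes a≤ = inj₁ (filter ¬tall? xs , a≤ , Unique.filter⁺ ¬tall? uniq , indep)
      where
      ¬tall? = λ x → ¬? (tall? (suc i) x)
      indep : Independent E (filter ¬tall? xs)
      indep u∈ v∈ with u∈xs , ¬tu ← ∈-filter⁻ ¬tall? {xs = xs} u∈
                     | v∈xs , ¬tv ← ∈-filter⁻ ¬tall? {xs = xs} v∈ =
        level-independent i (All.lookup tall u∈xs) ¬tu (All.lookup tall v∈xs) ¬tv
    ... | no a≰ with peel a ℓ (suc i) (filter (tall? (suc i)) xs) (Unique.filter⁺ _ uniq)
                       (All.all-filter (tall? (suc i)) xs) large′
      where
      open ≤-Reasoning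
      large′ : a * ℓ ℕ.< length (filter (tall? (suc i)) xs)
      large′ = +-cancelʳ-< a _ _ (begin-strict
        a * ℓ + a         ≡⟨ +-comm (a * ℓ) a ⟩
        a + a * ℓ         ≡⟨ *-suc a ℓ ⟨
        a * suc ℓ         <⟨ large ⟩
        length xs         ≡⟨ length-filter-split (tall? (suc i)) xs ⟩
        length (filter (tall? (suc i)) xs) + length (filter (λ x → ¬? (tall? (suc i) x)) xs)
                          ≤⟨ +-monoʳ-≤ _ (<⇒≤ (≰⇒> a≰)) ⟩
        length (filter (tall? (suc i)) xs) + a ∎)
    ...   | inj₁ indep = inj₁ indep
    ...   | inj₂ (u , t) = inj₂ (u , subst (λ j → Tall j u) (sym (+-suc i ℓ)) t)

    gallaiRoy : ∀ a ℓ → a * ℓ ℕ.< n → LargeIndependent a (allFin n) ⊎ LongPath ℓ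
    gallaiRoy a ℓ large
      with peel a ℓ 0 (allFin n) (Unique.allFin⁺ n) (All.universal (λ _ → tt) _)
             (subst (a * ℓ ℕ.<_) (sym (length-tabulate {n = n} (λ i → i))) large)
    ... | inj₁ indep   = inj₁ indep
    ... | inj₂ (u , t) with us , len , path ← tall⇒path ℓ u t =
      inj₂ (u , us , len , Linked.map proj₂ path ,
        -- An ascending path repeats no vertex, by transitivity and irreflexivity of the order.
        AllPairs.map (λ { u<v refl → <-irrefl u<v }) (Linked.Linked⇒AllPairs <-trans (Linked.map proj₁ path)))

  lookup-injective : ∀ {xs : List A} → Unique xs → ∀ i j → lookup xs i ≡ lookup xs j → i ≡ j
  lookup-injective (_ ∷ _)    zero    zero    _  = refl
  lookup-injective (x∉ ∷ _)   zero    (suc j) eq = ⊥-elim (All.lookup x∉ (∈-lookup j) eq)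
  lookup-injective (x∉ ∷ _)   (suc i) zero    eq = ⊥-elim (All.lookup x∉ (∈-lookup i) (sym eq))
  lookup-injective (_ ∷ uniq) (suc i) (suc j) eq = cong suc (lookup-injective uniq i j eq)

  -- The digraph induced on `xs` gets the positions in `xs` as vertices, so Gallai-Roy on `Fin`
  -- applies. `Unique xs` carries distinctness back from positions to elements.
  path-or-independent : {E : Rel A 0ℓ} → Decidable E → (∀ {u} → ¬ E u u) →
    ∀ a ℓ {xs} → Unique xs → a * ℓ ℕ.< length xs →
    (∃ λ ys → a ≤ length ys × All (_∈ xs) ys × Unique ys × Independent E ys) ⊎
    (∃₂ λ u us → length us ≡ ℓ × All (_∈ xs) (u ∷ us) × Linked E (u ∷ us) × Unique (u ∷ us))
  path-or-independent {E = E} E? E-irrefl a ℓ {xs} uniq large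
    with GallaiRoy.gallaiRoy (λ i j → E? (lookup xs i) (lookup xs j)) E-irrefl a ℓ large
  ... | inj₁ (is , a≤ , uniq′ , indep) = inj₁
    ( map (lookup xs) is
    , subst (a ≤_) (sym (length-map _ is)) a≤
    , All.map⁺ (All.universal ∈-lookup is)
    , Unique.map⁺ (lookup-injective uniq _ _) uniq′
    , indep′ )
    where
    indep′ : Independent E (map (lookup xs) is)
    indep′ u∈ v∈ with i , i∈ , refl ← ∈-map⁻ (lookup xs) u∈ | j , j∈ , refl ← ∈-map⁻ (lookup xs) v∈ =
      indep i∈ j∈
  ... | inj₂ (i , is , len , linked , uniq′) = inj₂
    ( lookup xs i , map (lookup xs) is , trans (length-map _ is) len
    , All.map⁺ {f = lookup xs} (All.universal ∈-lookup (i ∷ is))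
    , Linked.map⁺ linked
    , Unique.map⁺ (lookup-injective uniq _ _) uniq′ )

-- Greedy embedding of an oriented path, run by run

module Embeddings where

  open LongPaths
  open import Data.Fin.Base using (Fin; zero; suc; inject₁)
  open import Data.Fin.Properties using (injective⇒≤)
  open import Data.Empty using (⊥-elim)
  open import Data.List.Base using (List; []; _∷_; length; lookup; map; filter; tails; inits)
  open import Data.List.Membership.Propositional using (_∈_; _∉_; lose)
  open import Data.List.Membership.Propositional.Properties
  open import Data.List.Extrema.Nat using (v≤max⁺)
  open import Data.List.Relation.Unary.Any as Any using (Any; here; there)
  open import Data.List.Relation.Unary.Any.Properties using (lookup-index)
  open import Data.List.Relation.Unary.All as All using (All; []; _∷_)
  open import Data.List.Relation.Unary.All.Properties using (all-filter)
  open import Data.List.Relation.Unary.AllPairs using ([]; _∷_)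
  open import Data.List.Relation.Unary.Linked using (Linked; _∷_)
  open import Data.List.Relation.Unary.Unique.Propositional using (Unique)
  import Data.List.Relation.Unary.Unique.Propositional.Properties as Unique
  open import Data.Nat.Base as ℕ using (ℕ; zero; suc; _+_; _*_; _≤_; _<_; s≤s; z≤n)
  open import Data.Nat.Properties
    using (≤-reflexive; ≤-trans; +-cancelˡ-<; +-monoˡ-≤; +-suc; +-comm; m≤m+n; m≤n⇒m≤1+n; module ≤-Reasoning)
  open import Data.Product.Base using (∃; ∃₂; _×_; _,_; proj₁; proj₂)
  open import Data.Sum.Base using (_⊎_; inj₁; inj₂)
  open import Function.Base using (flip)
  open import Function.Definitions using (Injective)
  open import Relation.Binary.Core using (Rel)
  open import Relation.Binary.Definitions using (Decidable; DecidableEquality)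
  open import Relation.Binary.PropositionalEquality
  open import Relation.Nullary using (¬_; ¬?)
  open import Level using (0ℓ)

  private
    variable
      A B : Set

  opposite : Direction → Direction
  opposite forward  = backward
  opposite backward = forward

  same-or-opposite : ∀ d e → e ≡ d ⊎ e ≡ opposite d
  same-or-opposite forward  forward  = inj₁ refl
  same-or-opposite forward  backward = inj₂ refl
  same-or-opposite backward forward  = inj₂ refl
  same-or-opposite backward backward = inj₁ refl

  run : Direction → OrientedPath → ℕ
  run d        []             = 0
  run forward  (forward  ∷ P) = suc (run forward P)
  run forward  (backward ∷ P) = 0
  run backward (forward  ∷ P) = 0
  run backward (backward ∷ P) = suc (run backward P)

  run-∷ : ∀ d P → run d (d ∷ P) ≡ suc (run d P)
  run-∷ forward  P = refl
  run-∷ backward P = refl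

  -- Every tail is included because the embedding consumes the path edge by edge and must bound the
  -- run that begins after each turn.
  RunsBounded : ℕ → OrientedPath → Set
  RunsBounded ℓ P = All (λ Q → ∀ d → run d Q ≤ ℓ) (tails P)

  ∷-∈inits : ∀ {x : A} {xs ys} → xs ∈ inits ys → x ∷ xs ∈ inits (x ∷ ys)
  ∷-∈inits {x = x} {ys = []}    (here refl) = there (here refl)
  ∷-∈inits {x = x} {ys = _ ∷ _} (here refl) = there (here refl)
  ∷-∈inits {x = x} {ys = _ ∷ _} (there xs∈) = there (there (∈-map⁺ (x ∷_) xs∈))

  run-init : ∀ d P → ∃ λ Q → Q ∈ inits P × All (_≡ d) Q × length Q ≡ run d P
  run-init d        []             = [] , here refl , [] , refl
  run-init forward  (backward ∷ P) = [] , here refl , [] , refl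
  run-init backward (forward  ∷ P) = [] , here refl , [] , refl
  run-init forward  (forward  ∷ P) with Q , Q∈ , all , len ← run-init forward P =
    forward ∷ Q , ∷-∈inits Q∈ , refl ∷ all , cong suc len
  run-init backward (backward ∷ P) with Q , Q∈ , all , len ← run-init backward P =
    backward ∷ Q , ∷-∈inits Q∈ , refl ∷ all , cong suc len

  directed : ∀ d {P} → All (_≡ d) P → Directed P
  directed forward  = inj₁
  directed backward = inj₂

  directed-subpath≤l : ∀ P {Q} → Q ∈ subpaths P → Directed Q → length Q ≤ l P
  directed-subpath≤l P Q∈ dir = v≤max⁺ 0 _
    (inj₂ (Any.map ≤-reflexive (∈-map⁺ length (∈-filter⁺ directed? Q∈ dir))))

  runsBounded : ∀ P → RunsBounded (l P) P
  runsBounded P = All.tabulate λ {Q} Q∈tails d →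
    let R , R∈inits , all , len = run-init d Q
    in subst (_≤ l P) len
         (directed-subpath≤l P (∈-concatMap⁺ inits (lose Q∈tails R∈inits)) (directed d all))

  data Trace (E : Rel A 0ℓ) : OrientedPath → A → List A → Set where
    []       : ∀ {v} → Trace E [] v []
    forward  : ∀ {P v w ws} → E v w → Trace E P w ws → Trace E (forward ∷ P) v (w ∷ ws)
    backward : ∀ {P v w ws} → E w v → Trace E P w ws → Trace E (backward ∷ P) v (w ∷ ws)

  module _ {E : Rel A 0ℓ} where

    vertex : ∀ {P v vs} → Trace E P v vs → Fin ∣ P ∣ → A
    vertex {v = v} t zero = v
    vertex (forward  _ t) (suc i) = vertex t i
    vertex (backward _ t) (suc i) = vertex t i

    vertex∈ : ∀ {P v vs} (t : Trace E P v vs) i → vertex t i ∈ v ∷ vs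
    vertex∈ t zero = here refl
    vertex∈ (forward  _ t) (suc i) = there (vertex∈ t i)
    vertex∈ (backward _ t) (suc i) = there (vertex∈ t i)

    vertex-injective : ∀ {P v vs} (t : Trace E P v vs) → Unique (v ∷ vs) → Injective _≡_ _≡_ (vertex t)
    vertex-injective t uniq {zero} {zero} _ = refl
    vertex-injective (forward  _ t) (v∉ ∷ _) {zero} {suc j} eq = ⊥-elim (All.lookup v∉ (vertex∈ t j) eq)
    vertex-injective (backward _ t) (v∉ ∷ _) {zero} {suc j} eq = ⊥-elim (All.lookup v∉ (vertex∈ t j) eq)
    vertex-injective (forward  _ t) (v∉ ∷ _) {suc i} {zero} eq = ⊥-elim (All.lookup v∉ (vertex∈ t i) (sym eq))
    vertex-injective (backward _ t) (v∉ ∷ _) {suc i} {zero} eq = ⊥-elim (All.lookup v∉ (vertex∈ t i) (sym eq))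
    vertex-injective (forward  _ t) (_ ∷ uniq) {suc i} {suc j} eq = cong suc (vertex-injective t uniq eq)
    vertex-injective (backward _ t) (_ ∷ uniq) {suc i} {suc j} eq = cong suc (vertex-injective t uniq eq)

    trace-forward : ∀ {P v vs} (t : Trace E P v vs) e → lookup P e ≡ forward →
                    E (vertex t (inject₁ e)) (vertex t (suc e))
    trace-forward (forward vw t)  zero    refl = vw
    trace-forward (forward vw t)  (suc e) eq   = trace-forward t e eq
    trace-forward (backward wv t) (suc e) eq   = trace-forward t e eq

    trace-backward : ∀ {P v vs} (t : Trace E P v vs) e → lookup P e ≡ backward →
                     E (vertex t (suc e)) (vertex t (inject₁ e))
    trace-backward (backward wv t) zero    refl = wv
    trace-backward (forward vw t)  (suc e) eq   = trace-backward t e eq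
    trace-backward (backward wv t) (suc e) eq   = trace-backward t e eq

  trace⇒copy : ∀ {P H v vs} → Trace (Arc H) P v vs → Unique (v ∷ vs) → Copy (pathDigraph P) H
  trace⇒copy {P} {H} t uniq = vertex t , vertex-injective t uniq , λ {u} {v} → preserves {u} {v}
    where
    preserves : ∀ {u v} → PathArc P u v → Arc H (vertex t u) (vertex t v)
    preserves (forward e eq)  = trace-forward t e eq
    preserves (backward e eq) = trace-backward t e eq

  unique-⊆⇒length≤ : ∀ {xs ys : List A} → Unique xs → All (_∈ ys) xs → length xs ≤ length ys
  unique-⊆⇒length≤ {xs = xs} {ys} uniq xs⊆ys = injective⇒≤ position-injective
    where
    position : Fin (length xs) → Fin (length ys)
    position i = Any.index (All.lookup xs⊆ys (∈-lookup i))
    position-injective : Injective _≡_ _≡_ position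
    position-injective {i} {j} eq = lookup-injective uniq i j (begin
      lookup xs i            ≡⟨ lookup-index (All.lookup xs⊆ys (∈-lookup i)) ⟩
      lookup ys (position i) ≡⟨ cong (lookup ys) eq ⟩
      lookup ys (position j) ≡⟨ lookup-index (All.lookup xs⊆ys (∈-lookup j)) ⟨
      lookup xs j            ∎)
      where open ≡-Reasoning

  -- `part d` holds the vertices whose next edge on the path has direction `d`: `X` for `forward`,
  -- `Z` for `backward`. Indexing by the direction lets one argument serve both kinds of run.
  module Embedding
    (_≟ᵥ_ : DecidableEquality A) {E : Rel A 0ℓ} (E? : Decidable E) (E-irrefl : ∀ {u} → ¬ E u u)
    (part : Direction → List A) (unique : ∀ d → Unique (part d))
    where

    open import Data.List.Membership.DecPropositional _≟ᵥ_ using (_∈?_)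

    Dir : Direction → Rel A 0ℓ
    Dir forward  = E
    Dir backward = flip E

    dir? : ∀ d → Decidable (Dir d)
    dir? forward  u v = E? u v
    dir? backward u v = E? v u

    dir-irrefl : ∀ d {u} → ¬ Dir d u u
    dir-irrefl forward  = E-irrefl
    dir-irrefl backward = E-irrefl

    dir-independent : ∀ d {xs} → Independent (Dir d) xs → Independent E xs
    dir-independent forward  indep       = indep
    dir-independent backward indep u∈ v∈ = indep v∈ u∈

    _∷ₜ_ : ∀ {d P v w ws} → Dir d v w → Trace E P w ws → Trace E (d ∷ P) v (w ∷ ws)
    _∷ₜ_ {d = forward}  = forward
    _∷ₜ_ {d = backward} = backward

    -- At a turn, an edge of direction `d` is followed by one of the opposite direction, so its end
    -- must lie in the other part.
    neighbours : Direction → A → List A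
    neighbours d v = filter (dir? d v) (part (opposite d))

    -- `n` pays for the vertices already used. More than `a * ℓ` further ones let Gallai-Roy give a
    -- path with `ℓ` edges or an independent set of size `a`.
    module _ (a ℓ m n : ℕ) (a*ℓ+n<m : n + a * ℓ < m)
             (degree : ∀ d {v} → v ∈ part d → m ≤ length (neighbours d v)) where

      IndependentIn : Set
      IndependentIn = ∃ λ ys → a ≤ length ys × All (λ y → ∃ λ d → y ∈ part d) ys ×
                               Unique ys × Independent E ys

      -- rs is the directed path set aside for the rest of the run that starts at v or earlier.
      record Reserved (d : Direction) (us : List A) (v : A) (rs : List A) : Set where
        constructor reserved
        field
          inside : All (_∈ part d) (v ∷ rs)
          linked : Linked (Dir d) (v ∷ rs)
          uniq   : Unique (v ∷ rs)
          fresh  : All (_∉ us) (v ∷ rs)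

      reserve : ∀ d us xs → All (_∈ part d) xs → Unique xs → length us ≤ n → m ≤ length xs →
                IndependentIn ⊎ ∃₂ λ v rs → length rs ≡ ℓ × v ∈ xs × Reserved d us v rs
      reserve d us xs xs⊆ uniq us≤n m≤xs
        with path-or-independent (dir? d) (dir-irrefl d) a ℓ (Unique.filter⁺ unused? uniq) large
        where
        unused? = λ x → ¬? (x ∈? us)
        large : a * ℓ < length (filter unused? xs)
        large = +-cancelˡ-< n _ _ (begin-strict
          n + a * ℓ                          <⟨ a*ℓ+n<m ⟩
          m                                  ≤⟨ m≤xs ⟩
          length xs                          ≡⟨ length-filter-split (_∈? us) xs ⟩
          length (filter (_∈? us) xs) + length (filter unused? xs)
            ≤⟨ +-monoˡ-≤ _ (unique-⊆⇒length≤ (Unique.filter⁺ (_∈? us) uniq) (all-filter (_∈? us) xs)) ⟩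
          length us + length (filter unused? xs) ≤⟨ +-monoˡ-≤ _ us≤n ⟩
          n + length (filter unused? xs)     ∎)
          where open ≤-Reasoning
      ... | inj₁ (ys , a≤ , ys⊆ , uniq-ys , indep) =
        inj₁ (ys , a≤ , All.map (λ y∈ → d , All.lookup xs⊆ (proj₁ (∈-filter⁻ _ {xs = xs} y∈))) ys⊆
             , uniq-ys , dir-independent d indep)
      ... | inj₂ (v , rs , len , ys⊆@(v∈ ∷ _) , linked , uniq-ys) =
        inj₂ (v , rs , len , proj₁ (∈-filter⁻ _ {xs = xs} v∈) , record
          { inside = All.map (λ y∈ → All.lookup xs⊆ (proj₁ (∈-filter⁻ _ {xs = xs} y∈))) ys⊆
          ; linked = linked
          ; uniq   = uniq-ys
          ; fresh  = All.map (λ y∈ → proj₂ (∈-filter⁻ _ {xs = xs} y∈)) ys⊆ })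

      -- Every candidate is a neighbour of `v`, so the reserved path may start wherever Gallai-Roy
      -- puts it.
      turn : ∀ d us v → v ∈ part d → length (v ∷ us) ≤ n →
             IndependentIn ⊎ ∃₂ λ w rs → length rs ≡ ℓ × Dir d v w × Reserved (opposite d) (v ∷ us) w rs
      turn d us v v∈ us≤n
        with reserve (opposite d) (v ∷ us) (neighbours d v)
               (All.tabulate λ w∈ → proj₁ (∈-filter⁻ _ {xs = part (opposite d)} w∈))
               (Unique.filter⁺ _ (unique (opposite d))) us≤n (degree d v∈)
      ... | inj₁ indep = inj₁ indep
      ... | inj₂ (w , rs , len , w∈ , res) =
        inj₂ (w , rs , len , proj₂ (∈-filter⁻ (dir? d v) {xs = part (opposite d)} w∈) , res)

      TraceFrom : OrientedPath → List A → A → Set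
      TraceFrom P us v = ∃ λ ws → Trace E P v ws × Unique (v ∷ ws) × All (_∉ us) (v ∷ ws)

      extend : ∀ {d P us v w} → v ∉ us → Dir d v w → TraceFrom P (v ∷ us) w → TraceFrom (d ∷ P) us v
      extend {us = us} {v} v∉us vw (ws , t , uniq , fresh) =
        _ , vw ∷ₜ t , All.map (λ x∉ v≡x → x∉ (here (sym v≡x))) fresh ∷ uniq
          , v∉us ∷ All.map (λ x∉ x∈ → x∉ (there x∈)) fresh

      -- The last edge of a run leaves the reserved path: its end already belongs to the other part
      -- and is found by a degree. Hence `rs` has to cover `run d P` edges, one fewer than the run
      -- of `d ∷ P`.
      embed : ∀ d P us {v rs} → Reserved d us v rs → run d P ≤ length rs → RunsBounded ℓ P →
              length us + suc (length P) ≤ n → IndependentIn ⊎ TraceFrom (d ∷ P) us v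
      embed d [] us {v} (reserved (v∈ ∷ _) _ _ (v∉us ∷ _)) _ _ us≤n
        with turn d us v v∈ (subst (_≤ n) (+-comm (length us) 1) us≤n)
      ... | inj₁ indep = inj₁ indep
      ... | inj₂ (w , rs , _ , vw , reserved _ _ _ (w∉ ∷ _)) =
        inj₂ (extend v∉us vw ([] , [] , [] ∷ [] , w∉ ∷ []))
      embed d (e ∷ P) us {v} {rs} res@(reserved (v∈ ∷ inside) linked uniq (v∉us ∷ fresh)) run≤ (bound ∷ bounds) us≤n
        with same-or-opposite d e
      ... | inj₂ refl with turn d us v v∈ (≤-trans (s≤s (m≤m+n (length us) _)) (subst (_≤ n) (+-suc (length us) _) us≤n))
      ...   | inj₁ indep = inj₁ indep
      ...   | inj₂ (w , rs′ , refl , vw , res′)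
        -- The run beginning with `e` has at most `ℓ` edges, so the `ℓ` reserved ones suffice.
        with embed e P (v ∷ us) res′ (ℕ.s≤s⁻¹ (m≤n⇒m≤1+n (subst (_≤ _) (run-∷ e P) (bound e)))) bounds
               (subst (_≤ n) (+-suc (length us) _) us≤n)
      ...     | inj₁ indep = inj₁ indep
      ...     | inj₂ t     = inj₂ (extend v∉us vw t)
      embed d (e ∷ P) us {v} {[]} res run≤ _ us≤n | inj₁ refl
        with () ← subst (_≤ 0) (run-∷ d P) run≤
      embed d (e ∷ P) us {v} {w ∷ rs} (reserved (v∈ ∷ inside) (vw ∷ linked) ((v≢w ∷ v≢rs) ∷ uniq) (v∉us ∷ fresh)) run≤ (_ ∷ bounds) us≤n | inj₁ refl
        with embed d P (v ∷ us)
               (reserved inside linked uniq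
                 (All.zipWith (λ { (v≢x , x∉us) (here x≡v) → v≢x (sym x≡v) ; (v≢x , x∉us) (there x∈) → x∉us x∈ }) (v≢w ∷ v≢rs , fresh)))
               (ℕ.s≤s⁻¹ (subst (_≤ _) (run-∷ d P) run≤)) bounds
               (subst (_≤ n) (+-suc (length us) _) us≤n)
      ... | inj₁ indep = inj₁ indep
      ... | inj₂ t     = inj₂ (extend v∉us vw t)

      embedPath : ∀ P → 1 ≤ length P → RunsBounded ℓ P → length P ≤ n → (∀ d → m ≤ length (part d)) →
                  IndependentIn ⊎ ∃₂ λ v ws → Trace E P v ws × Unique (v ∷ ws)
      embedPath (d ∷ P) _ (bound ∷ bounds) P≤n large
        -- Before the first vertex there is no neighbourhood, and the whole part takes its place;
        -- hence the size condition on the parts.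
        with reserve d [] (part d) (All.tabulate λ x∈ → x∈) (unique d) z≤n (large d)
      ... | inj₁ indep = inj₁ indep
      ... | inj₂ (v , rs , refl , _ , res)
        with embed d P [] res (ℕ.s≤s⁻¹ (m≤n⇒m≤1+n (subst (_≤ _) (run-∷ d P) (bound d)))) bounds P≤n
      ...   | inj₁ indep = inj₁ indep
      ...   | inj₂ (ws , t , uniq , _) = inj₂ (v , ws , t , uniq)

-- The upper bound by induction on the number of colours

module UpperBound where

  open Counting
  open LongPaths
  open Embeddings
  open import Data.Bool.Base using (T; if_then_else_)
  open import Data.Bool.Properties using (T?)
  open import Data.Fin.Base as Fin using (Fin; zero; suc)
  import Data.Fin.Properties as Fin
  open import Data.Empty using (⊥-elim)
  open import Data.List.Base using (List; []; _∷_; _++_; length; lookup; map)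
  open import Data.List.Properties using (length-++; length-filter)
  open import Data.List.Membership.Propositional using (_∈_; _∉_; find)
  open import Data.List.Membership.Propositional.Properties
  open import Data.List.Relation.Unary.Any using (here; there; any?)
  open import Data.List.Relation.Unary.All as All using (All; []; _∷_)
  open import Data.List.Relation.Unary.All.Properties using (¬Any⇒All¬)
  open import Data.List.Relation.Unary.AllPairs using ([]; _∷_)
  open import Data.List.Relation.Unary.Unique.Propositional using (Unique)
  open import Data.List.Relation.Binary.Sublist.Propositional using (_⊆_; []; _∷_; _∷ʳ_) renaming (lookup to ⊆-lookup)
  open import Data.List.Relation.Binary.Sublist.Propositional.Properties using (All-resp-⊆)
  open import Data.Nat.Base as ℕ using (ℕ; zero; suc; _+_; _*_; _≤_; _<_; s≤s; z≤n)
  open import Data.Nat.ListAction using (product)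
  open import Data.Nat.Properties
  open import Data.Nat.Tactic.RingSolver using (solve-∀)
  open import Data.Product.Base using (∃; _×_; _,_; proj₂)
  open import Data.Sum.Base as Sum using (_⊎_; inj₁; inj₂)
  open import Relation.Binary.Definitions using (Decidable; tri<; tri≈; tri>)
  open import Relation.Binary.PropositionalEquality
  open import Relation.Nullary using (Dec; yes; no; ¬_; _×-dec_; does)

  private
    variable
      A B : Set

  indicator : ∀ {P : Set} → Dec P → ℕ
  indicator P? = if does P? then 1 else 0

  indicator-true : ∀ {P : Set} (P? : Dec P) → P → 1 ≤ indicator P?
  indicator-true (yes _) _ = ≤-refl
  indicator-true (no ¬p) p = ⊥-elim (¬p p)

  ∈⇒≤∑ : ∀ {xs : List A} {x} (f : A → ℕ) → x ∈ xs → f x ≤ ∑ xs f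
  ∈⇒≤∑ f (here refl) = m≤m+n _ _
  ∈⇒≤∑ {xs = y ∷ _} f (there x∈) = m≤n⇒m≤o+n (f y) (∈⇒≤∑ f x∈)

  product-split : ∀ (f : A → ℕ) xs {x} ys →
                  product (map f (xs ++ x ∷ ys)) ≡ f x * product (map f (xs ++ ys))
  product-split f []        ys = refl
  product-split f (y ∷ xs) {x} ys rewrite product-split f xs {x} ys = swap (f y) (f x) _
    where
    swap : ∀ a b c → a * (b * c) ≡ b * (a * c)
    swap = solve-∀

  Unique-resp-⊆ : ∀ {xs ys : List A} → xs ⊆ ys → Unique ys → Unique xs
  Unique-resp-⊆ []         []           = []
  Unique-resp-⊆ (_ ∷ʳ τ)   (_ ∷ uniq)   = Unique-resp-⊆ τ uniq
  Unique-resp-⊆ (refl ∷ τ) (y∉ ∷ uniq)  = All-resp-⊆ τ y∉ ∷ Unique-resp-⊆ τ uniq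

  count-≡ : ∀ {n} {xs : List (Fin n)} → Unique xs → ∀ x → count (x Fin.≟_) xs ≤ 1
  count-≡ []                    x = z≤n
  count-≡ {xs = y ∷ ys} (y∉ ∷ uniq) x with x Fin.≟ y
  ... | no _     = count-≡ uniq x
  ... | yes refl = s≤s (≤-reflexive (trans (zeros ys y∉) (trans (∑-const ys 0) (*-zeroʳ (length ys)))))
    where
    zeros : ∀ zs → All (x ≢_) zs → count (x Fin.≟_) zs ≡ ∑ zs (λ _ → 0)
    zeros []       []          = refl
    zeros (z ∷ zs) (x≢z ∷ x≢) with x Fin.≟ z
    ... | yes x≡z = ⊥-elim (x≢z x≡z)
    ... | no _    = zeros zs x≢

  module Colour {k N} (𝒯 : Tournament N) (χ : Colouring k N) where

    _⟶[_]_ : Fin N → Fin k → Fin N → Set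
    u ⟶[ c ] v = T (edge 𝒯 u v) × χ u v ≡ c

    arc? : ∀ c → Decidable (λ u v → u ⟶[ c ] v)
    arc? c u v = T? (edge 𝒯 u v) ×-dec (χ u v Fin.≟ c)

    arc-irrefl : ∀ c {u} → ¬ u ⟶[ c ] u
    arc-irrefl c {u} (e , _) with tournament 𝒯 u u
    ... | tri< _ u≢u _ = u≢u refl
    ... | tri≈ ¬e _ _  = ¬e e
    ... | tri> _ u≢u _ = u≢u refl

    -- The induction runs over lists of colours still present, so that removing a colour never
    -- requires recoding `χ`.
    ColouredBy : List (Fin k) → List (Fin N) → Set
    ColouredBy cs U = ∀ {u v} → u ∈ U → v ∈ U → T (edge 𝒯 u v) → χ u v ∈ cs

    arcsOf : Fin k → List (Fin N) → ℕ
    arcsOf c U = arcs (arc? c) U U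

    -- Count ordered pairs: each is on the diagonal or joined by an arc in one of the two
    -- directions, in a colour of `cs`. Every arc serves two ordered pairs, whence the doubled
    -- summand.
    length²≤ : ∀ {cs U} → Unique U → ColouredBy cs U →
               length U * length U ≤ length U + ∑ cs (λ c → arcsOf c U + arcsOf c U)
    length²≤ {cs} {U} uniq coloured = begin
      n * n                                          ≡⟨ ∑-const U n ⟨
      ∑ U (λ _ → n)                                  ≤⟨ ∑-mono-≤ U row ⟩
      ∑ U (λ u → 1 + ∑ cs (λ c → out u c + inn u c)) ≡⟨ ∑-distrib-+ U (λ _ → 1) _ ⟩
      ∑ U (λ _ → 1) + ∑ U (λ u → ∑ cs (λ c → out u c + inn u c))
        ≡⟨ cong₂ _+_ (trans (∑-const U 1) (*-identityʳ n)) (∑-comm U cs (λ u c → out u c + inn u c)) ⟩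
      n + ∑ cs (λ c → ∑ U (λ u → out u c + inn u c)) ≡⟨ cong (n +_) (∑-cong cs column) ⟩
      n + ∑ cs (λ c → arcsOf c U + arcsOf c U)       ∎
      where
      open ≤-Reasoning
      n = length U
      out inn : Fin N → Fin k → ℕ
      out u c = outdegree (arc? c) U u
      inn u c = indegree (arc? c) U u
      column : ∀ c → ∑ U (λ u → out u c + inn u c) ≡ arcsOf c U + arcsOf c U
      column c = trans (∑-distrib-+ U (λ u → out u c) (λ u → inn u c))
                   (cong (arcsOf c U +_) (sym (arcs≡∑indegree (arc? c) U U)))
      pairs : Fin N → Fin N → ℕ
      pairs u v = ∑ cs (λ c → indicator (arc? c u v) + indicator (arc? c v u))
      pair : ∀ {u v} → u ∈ U → v ∈ U → 1 ≤ indicator (u Fin.≟ v) + pairs u v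
      pair {u} {v} u∈ v∈ with tournament 𝒯 u v
      ... | tri< e _ _ = m≤n⇒m≤o+n (indicator (u Fin.≟ v)) (≤-trans
              (m≤n⇒m≤n+o (indicator (arc? (χ u v) v u)) (indicator-true (arc? (χ u v) u v) (e , refl)))
              (∈⇒≤∑ (λ c → indicator (arc? c u v) + indicator (arc? c v u)) (coloured u∈ v∈ e)))
      ... | tri≈ _ u≡v _ = m≤n⇒m≤n+o (pairs u v) (indicator-true (u Fin.≟ v) u≡v)
      ... | tri> _ _ e = m≤n⇒m≤o+n (indicator (u Fin.≟ v)) (≤-trans
              (m≤n⇒m≤o+n (indicator (arc? (χ v u) u v)) (indicator-true (arc? (χ v u) v u) (e , refl)))
              (∈⇒≤∑ (λ c → indicator (arc? c u v) + indicator (arc? c v u)) (coloured v∈ u∈ e)))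
      row : ∀ {u} → u ∈ U → n ≤ 1 + ∑ cs (λ c → out u c + inn u c)
      row {u} u∈ = begin
        n                                                  ≡⟨ *-identityʳ n ⟨
        n * 1                                              ≡⟨ ∑-const U 1 ⟨
        ∑ U (λ _ → 1)                                      ≤⟨ ∑-mono-≤ U (pair u∈) ⟩
        ∑ U (λ v → indicator (u Fin.≟ v) + pairs u v)      ≡⟨ ∑-distrib-+ U _ (pairs u) ⟩
        count (u Fin.≟_) U + ∑ U (pairs u)                 ≤⟨ +-monoˡ-≤ _ (count-≡ uniq u) ⟩
        1 + ∑ U (pairs u)                                  ≡⟨ cong suc (∑-comm U cs (λ v c → indicator (arc? c u v) + indicator (arc? c v u))) ⟩
        1 + ∑ cs (λ c → ∑ U (λ v → indicator (arc? c u v) + indicator (arc? c v u)))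
          ≡⟨ cong suc (∑-cong cs (λ c → ∑-distrib-+ U _ _)) ⟩
        1 + ∑ cs (λ c → out u c + inn u c)                 ∎

    -- If every colour had at most `2mn` arcs on `n` vertices, `length²≤` would give n² ≤ n + 4mn ·
    -- `length cs`; cancelling `n` contradicts the size. The density found is the one that
    -- `denseCore` asks for when both sides are `U`.
    popular-colour : ∀ m {cs U} → Unique U → ColouredBy cs U →
                     1 + length cs * (m * 4) < length U →
                     ∃ λ c → c ∈ cs × m * (length U + length U) < arcsOf c U
    popular-colour m {cs} {U} uniq coloured large
      with any? (λ c → m * (length U + length U) <? arcsOf c U) cs
    ... | yes popular = find popular
    ... | no ¬popular = ⊥-elim (<⇒≱ large (*-cancelˡ-≤ n {{ℕ.>-nonZero (≤-<-trans z≤n large)}} (begin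
      n * n                                           ≤⟨ length²≤ uniq coloured ⟩
      n + ∑ cs (λ c → arcsOf c U + arcsOf c U)        ≤⟨ +-monoʳ-≤ n (∑-mono-≤ cs λ c∈ → +-mono-≤ (rare c∈) (rare c∈)) ⟩
      n + ∑ cs (λ _ → m * (n + n) + m * (n + n))      ≡⟨ cong (n +_) (∑-const cs _) ⟩
      n + length cs * (m * (n + n) + m * (n + n))     ≡⟨ shuffle n m (length cs) ⟩
      n * (1 + length cs * (m * 4))                   ∎)))
      where
      open ≤-Reasoning
      n = length U
      rare : ∀ {c} → c ∈ cs → arcsOf c U ≤ m * (n + n)
      rare c∈ = ≮⇒≥ (All.lookup (¬Any⇒All¬ cs ¬popular) c∈)
      shuffle : ∀ n m j → n + j * (m * (n + n) + m * (n + n)) ≡ n * (1 + j * (m * 4))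
      shuffle = solve-∀

  -- With no colour left, two vertices are already too many, as they span an edge. Otherwise
  -- `C n + 3` is the factor in `threshold`, multiplied by 4 and by the number of colours in
  -- `popular-colour`; the leading 2 absorbs the summand 1 there and gives strictness.
  C : ℕ → ℕ
  C zero    = 2
  C (suc n) = 2 + suc n * ((C n + 3) * 4)

  -- D stands for the maximum of Lᵢ / lᵢ, rounded up.
  module Ramsey {k N} (𝒯 : Tournament N) (χ : Colouring k N) (P : Fin k → OrientedPath)
                (P≥1 : ∀ i → 1 ≤ L (P i)) (D : ℕ) (L≤Dl : ∀ i → L (P i) ≤ D * l (P i)) (1≤D : 1 ≤ D) where
    open Colour 𝒯 χ

    lengths : List (Fin k) → ℕ
    lengths cs = product (map (λ i → l (P i)) cs)

    1≤lengths : ∀ cs → 1 ≤ lengths cs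
    1≤lengths []       = ≤-refl
    1≤lengths (c ∷ cs) = *-mono-≤ (ℕ.>-nonZero⁻¹ _ {{l-nonZero (P c) (P≥1 c)}}) (1≤lengths cs)

    R : List (Fin k) → ℕ
    R cs = C (length cs) * (D * lengths cs)

    Monochromatic : Set
    Monochromatic = ∃ λ i → Copy (pathDigraph (P i)) (colourClass 𝒯 χ i)

    RamseyFor : List (Fin k) → Set
    RamseyFor cs = ∀ {U} → Unique U → ColouredBy cs U → R cs ≤ length U → Monochromatic

    module Core {U X Z} (uniq : Unique U) (X⊆U : X ⊆ U) (Z⊆U : Z ⊆ U) (nonempty : 0 < length X)
                (c : Fin k) (a m : ℕ) (room : L (P c) + a * l (P c) < m)
                (out : All (λ x → m ≤ outdegree (arc? c) Z x) X)
                (inn : All (λ z → m ≤ indegree (arc? c) X z) Z) where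

      part : Direction → List (Fin N)
      part forward  = X
      part backward = Z

      part⊆ : ∀ d → part d ⊆ U
      part⊆ forward  = X⊆U
      part⊆ backward = Z⊆U

      open Embedding Fin._≟_ (arc? c) (arc-irrefl c) part (λ d → Unique-resp-⊆ (part⊆ d) uniq)

      degree : ∀ d {v} → v ∈ part d → m ≤ length (neighbours d v)
      degree forward  v∈ = subst (m ≤_) (count≡length-filter _ Z) (All.lookup out v∈)
      degree backward v∈ = subst (m ≤_) (count≡length-filter _ X) (All.lookup inn v∈)

      part-large : ∀ d {v} → v ∈ part d → m ≤ length (part (opposite d))
      part-large d v∈ = ≤-trans (degree d v∈) (length-filter _ (part (opposite d)))

      head∈ : ∀ {xs : List (Fin N)} → 0 < length xs → ∃ (_∈ xs)
      head∈ {x ∷ _} _ = x , here refl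

      -- A vertex of `X` has `m` out-neighbours in `Z`. As `room` makes `m` positive, `Z` then has a
      -- vertex, whose in-neighbours make `X` large.
      parts-large : ∀ d → m ≤ length (part d)
      parts-large backward = part-large forward (proj₂ (head∈ nonempty))
      parts-large forward  = part-large backward (proj₂ (head∈ (≤-trans (≤-<-trans z≤n room) (parts-large backward))))

      copy-or-independent : Copy (pathDigraph (P c)) (colourClass 𝒯 χ c) ⊎
        (∃ λ ys → a ≤ length ys × All (_∈ U) ys × Unique ys × Independent (λ u v → u ⟶[ c ] v) ys)
      copy-or-independent
        with embedPath a (l (P c)) m (L (P c)) room degree (P c) (P≥1 c) (runsBounded (P c)) ≤-refl parts-large
      ... | inj₂ (v , ws , t , uniq-t) = inj₁ (trace⇒copy t uniq-t)
      ... | inj₁ (ys , a≤ , ys⊆ , uniq-ys , indep) =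
        inj₂ (ys , a≤ , All.map (λ (d , y∈) → ⊆-lookup (part⊆ d) y∈) ys⊆ , uniq-ys , indep)

    coloured-rest : ∀ as {c bs U ys} → ColouredBy (as ++ c ∷ bs) U → All (_∈ U) ys →
                    Independent (λ u v → u ⟶[ c ] v) ys → ColouredBy (as ++ bs) ys
    coloured-rest as coloured ys⊆U indep u∈ v∈ e
      with ∈-++⁻ as (coloured (All.lookup ys⊆U u∈) (All.lookup ys⊆U v∈) e)
    ... | inj₁ ∈as         = ∈-++⁺ˡ ∈as
    ... | inj₂ (here χ≡c)  = ⊥-elim (indep u∈ v∈ (e , χ≡c))
    ... | inj₂ (there ∈bs) = ∈-++⁺ʳ as ∈bs

    no-colours : RamseyFor []
    no-colours {[]}        _    _ R≤ with () ← ≤-trans (*-monoʳ-≤ 2 (*-mono-≤ 1≤D (≤-refl {1}))) R≤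
    no-colours {_ ∷ []}    _    _ R≤ with s≤s () ← ≤-trans (*-monoʳ-≤ 2 (*-mono-≤ 1≤D (≤-refl {1}))) R≤
    no-colours {u ∷ v ∷ _} ((u≢v ∷ _) ∷ _) coloured R≤ with tournament 𝒯 u v
    ... | tri< e _ _ with () ← coloured (here refl) (there (here refl)) e
    ... | tri≈ _ u≡v _ = ⊥-elim (u≢v u≡v)
    ... | tri> _ _ e with () ← coloured (there (here refl)) (here refl) e

    -- The minimum degree demanded in the core of a colour of `cs`, with `n` colours remaining after
    -- its removal. `C n` accounts for the set free of that colour; the 3 covers the used vertices
    -- and strictness.
    threshold : List (Fin k) → ℕ → ℕ
    threshold cs n = (C n + 3) * (D * lengths cs)

    popular-large : ∀ n cs → length cs ≡ suc n → 1 + length cs * (threshold cs n * 4) < R cs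
    popular-large n cs len rewrite len = begin-strict
      1 + suc n * (threshold cs n * 4)    <⟨ +-monoˡ-≤ _ (*-monoʳ-≤ 2 (*-mono-≤ 1≤D (1≤lengths cs))) ⟩
      2 * Q + suc n * (threshold cs n * 4) ≡⟨ shuffle (C n + 3) (suc n) Q ⟩
      (2 + suc n * ((C n + 3) * 4)) * Q   ∎
      where
      open ≤-Reasoning
      Q = D * lengths cs
      shuffle : ∀ a b q → 2 * q + b * (a * q * 4) ≡ (2 + b * (a * 4)) * q
      shuffle = solve-∀

    -- The value for the other colours is multiplied by exactly `l (P c)`, which completes the
    -- product of lengths. The extra `L (P c)` is at most `D * l (P c)`, hence at most one more copy
    -- of `D` times that product.
    room : ∀ as c bs → L (P c) + R (as ++ bs) * l (P c) < threshold (as ++ c ∷ bs) (length (as ++ bs))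
    room as c bs = begin-strict
      L (P c) + K * (D * r) * ℓ    ≤⟨ +-monoˡ-≤ _ L≤Q ⟩
      D * (ℓ * r) + K * (D * r) * ℓ <⟨ m<n+m _ (*-mono-≤ 1≤D (*-mono-≤ 1≤ℓ (1≤lengths (as ++ bs)))) ⟩
      D * (ℓ * r) + (D * (ℓ * r) + K * (D * r) * ℓ) ≤⟨ m≤n+m _ (D * (ℓ * r)) ⟩
      D * (ℓ * r) + (D * (ℓ * r) + (D * (ℓ * r) + K * (D * r) * ℓ)) ≡⟨ shuffle K D r ℓ ⟩
      (K + 3) * (D * (ℓ * r))      ≡⟨ cong (λ p → (K + 3) * (D * p)) (product-split (λ i → l (P i)) as bs) ⟨
      threshold (as ++ c ∷ bs) (length (as ++ bs)) ∎
      where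
      open ≤-Reasoning
      ℓ = l (P c)
      r = lengths (as ++ bs)
      K = C (length (as ++ bs))
      1≤ℓ : 1 ≤ ℓ
      1≤ℓ = ℕ.>-nonZero⁻¹ _ {{l-nonZero (P c) (P≥1 c)}}
      L≤Q : L (P c) ≤ D * (ℓ * r)
      L≤Q = ≤-trans (L≤Dl c) (*-monoʳ-≤ D (subst (_≤ ℓ * r) (*-identityʳ ℓ) (*-monoʳ-≤ ℓ (1≤lengths (as ++ bs)))))
      shuffle : ∀ k d r l → d * (l * r) + (d * (l * r) + (d * (l * r) + k * (d * r) * l)) ≡ (k + 3) * (d * (l * r))
      shuffle = solve-∀

    module Step (as : List (Fin k)) (c : Fin k) (bs : List (Fin k)) (ih : RamseyFor (as ++ bs))
                {U} (uniq : Unique U) (coloured : ColouredBy (as ++ c ∷ bs) U) where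

      m : ℕ
      m = threshold (as ++ c ∷ bs) (length (as ++ bs))

      independent⇒mono : (∃ λ ys → R (as ++ bs) ≤ length ys × All (_∈ U) ys × Unique ys ×
                            Independent (λ u v → u ⟶[ c ] v) ys) → Monochromatic
      independent⇒mono (ys , R≤ys , ys⊆U , uniq-ys , indep) =
        ih uniq-ys (coloured-rest as coloured ys⊆U indep) R≤ys

      core⇒mono : DenseCore (arc? c) m U U → Monochromatic
      core⇒mono (X , Z , X⊆U , Z⊆U , nonempty , out , inn) =
        Sum.[ (c ,_) , independent⇒mono ]′
          (Core.copy-or-independent uniq X⊆U Z⊆U nonempty c (R (as ++ bs)) m (room as c bs) out inn)

      dense⇒mono : m * (length U + length U) < arcsOf c U → Monochromatic
      dense⇒mono dense = core⇒mono (denseCore (arc? c) m U U dense)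

    -- The recursion is on the number of colours and not on the list, because the popular colour may
    -- sit anywhere in `cs`.
    ramsey : ∀ n cs → length cs ≡ n → RamseyFor cs

    ramsey-split : ∀ n as c bs → length (as ++ c ∷ bs) ≡ suc n → ∀ {U} → Unique U →
                   ColouredBy (as ++ c ∷ bs) U →
                   threshold (as ++ c ∷ bs) n * (length U + length U) < arcsOf c U → Monochromatic
    ramsey-split n as c bs len {U} uniq coloured dense =
      Step.dense⇒mono as c bs (ramsey n (as ++ bs) len-rest) uniq coloured
        (subst (λ j → threshold (as ++ c ∷ bs) j * (length U + length U) < arcsOf c U) (sym len-rest) dense)
      where
      len-rest : length (as ++ bs) ≡ n
      len-rest = suc-injective (trans (sym (trans (length-++ as) (trans (+-suc _ _) (cong suc (sym (length-++ as)))))) len)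

    ramsey-popular : ∀ n cs → length cs ≡ suc n → ∀ {U} → Unique U → ColouredBy cs U →
                     (∃ λ c → c ∈ cs × threshold cs n * (length U + length U) < arcsOf c U) → Monochromatic
    ramsey-popular n cs len uniq coloured (c , c∈ , dense) with ∈-∃++ c∈
    ... | as , bs , refl = ramsey-split n as c bs len uniq coloured dense

    ramsey zero    []  _   = no-colours
    ramsey (suc n) cs  len uniq coloured R≤ = ramsey-popular n cs len uniq coloured
      (popular-colour (threshold cs n) uniq coloured (<-≤-trans (popular-large n cs len) R≤))

-- Deciding unavoidability by exhaustive search

module Search where

  open import Data.Bool.Base using (Bool; true; false; T)
  open import Data.Bool.Properties using (T?)
  open import Data.Fin.Base as Fin using (Fin; zero; suc; inject₁)
  import Data.Fin.Properties as Fin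
  open import Data.List.Base using (lookup)
  open import Data.Nat.Base using (ℕ; zero; suc; _≤_; _<_)
  open import Data.Nat.Properties using (anyUpTo?; ≮⇒≥; ≤-refl; ≤-trans; <⇒≤)
  open import Data.Nat.Induction using (<-rec)
  open import Data.Product.Base using (∃; _×_; _,_; proj₁; proj₂)
  open import Data.Sum.Base as Sum using (_⊎_; inj₁; inj₂)
  open import Data.Vec.Functional using (_∷_)
  open import Function.Base using (_∘_)
  open import Relation.Binary.Core using (Rel)
  open import Relation.Binary.Definitions using (Decidable; Reflexive; Trichotomous; Tri; tri<; tri≈; tri>; _Respects_)
  open import Relation.Binary.PropositionalEquality hiding (_≗_)
  open import Relation.Nullary using (Dec; yes; no; ¬_; ¬?; _×-dec_; _⊎-dec_; _→-dec_)
  open import Relation.Nullary.Decidable using (map′; decidable-stable)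
  open import Relation.Unary using (Pred) renaming (Decidable to Decidable₁)
  open import Level using (0ℓ)

  private
    variable
      A B : Set

  -- Exhaustive search in a finite type, for predicates respecting _≈_. The
  -- relation makes up for the lack of function extensionality.
  Searchable : (A : Set) → Rel A 0ℓ → Set₁
  Searchable A _≈_ = ∀ {P : Pred A 0ℓ} → P Respects _≈_ → Decidable₁ P → Dec (∃ P)

  Fin-searchable : ∀ n → Searchable (Fin n) _≡_
  Fin-searchable n _ = Fin.any?

  Bool-searchable : Searchable Bool _≡_
  Bool-searchable _ P? = map′
    (Sum.[ true ,_ , false ,_ ]′)
    (λ { (true , p) → inj₁ p ; (false , p) → inj₂ p })
    (P? true ⊎-dec P? false)

  Pointwise : Rel B 0ℓ → Rel (A → B) 0ℓ
  Pointwise _≈_ f g = ∀ x → f x ≈ g x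

  →-searchable : ∀ {_≈_ : Rel B 0ℓ} → Reflexive _≈_ → Searchable B _≈_ →
                 ∀ n → Searchable (Fin n → B) (Pointwise _≈_)
  →-searchable {B = B} ≈-refl search zero resp P? =
    map′ (empty ,_) (λ (f , p) → resp {f} {empty} (λ ()) p) (P? empty)
    where
    empty : Fin 0 → B
    empty ()
  →-searchable ≈-refl search (suc n) {P} resp P? = map′
    (λ (b , f , p) → b ∷ f , p)
    (λ (f , p) → f zero , f ∘ suc , resp (λ { zero → ≈-refl ; (suc _) → ≈-refl }) p)
    (search (λ b≈c (f , p) → f , resp (λ { zero → b≈c ; (suc _) → ≈-refl }) p) λ b →
      →-searchable ≈-refl search n (λ f≈g → resp λ { zero → ≈-refl ; (suc i) → f≈g i }) λ f → P? (b ∷ f))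

  T-tri? : ∀ {P : Set} a b → Dec P → Dec (Tri (T a) P (T b))
  T-tri? true  true  _       = no λ { (tri< _ _ ¬b) → ¬b _ ; (tri≈ ¬a _ _) → ¬a _ ; (tri> ¬a _ _) → ¬a _ }
  T-tri? true  false (yes p) = no λ { (tri< _ ¬p _) → ¬p p ; (tri≈ ¬a _ _) → ¬a _ ; (tri> ¬a _ _) → ¬a _ }
  T-tri? true  false (no ¬p) = yes (tri< _ ¬p λ ())
  T-tri? false true  (yes p) = no λ { (tri< () _ _) ; (tri≈ _ _ ¬b) → ¬b _ ; (tri> _ ¬p _) → ¬p p }
  T-tri? false true  (no ¬p) = yes (tri> (λ ()) ¬p _)
  T-tri? false false (yes p) = yes (tri≈ (λ ()) p λ ())
  T-tri? false false (no ¬p) = no λ { (tri< () _ _) ; (tri≈ _ p _) → ¬p p ; (tri> _ _ ()) }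

  copy? : ∀ P {H} → Decidable (Arc H) → Dec (Copy (pathDigraph P) H)
  copy? P {H} arc? = map′
    (λ (f , inj , arcs) → f , (λ {u} {v} → inj u v) , λ { (forward e eq) → proj₁ (arcs e) eq ; (backward e eq) → proj₂ (arcs e) eq })
    (λ (f , inj , arcs) → f , (λ u v → inj) , λ e → (λ eq → arcs (forward e eq)) , (λ eq → arcs (backward e eq)))
    (→-searchable refl (Fin-searchable (order H)) ∣ P ∣ respects embedding?)
    where
    Embedding : (Fin ∣ P ∣ → Fin (order H)) → Set
    Embedding f = (∀ u v → f u ≡ f v → u ≡ v) ×
      (∀ e → (lookup P e ≡ forward  → Arc H (f (inject₁ e)) (f (suc e))) ×
             (lookup P e ≡ backward → Arc H (f (suc e)) (f (inject₁ e))))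

    respects : Embedding Respects (Pointwise _≡_)
    respects f≗g (inj , arcs) =
      (λ u v eq → inj u v (trans (f≗g u) (trans eq (sym (f≗g v))))) ,
      λ e → (λ eq → subst₂ (Arc H) (f≗g _) (f≗g _) (proj₁ (arcs e) eq)) ,
            (λ eq → subst₂ (Arc H) (f≗g _) (f≗g _) (proj₂ (arcs e) eq))

    embedding? : Decidable₁ Embedding
    embedding? f =
      Fin.all? (λ u → Fin.all? λ v → (f u Fin.≟ f v) →-dec (u Fin.≟ v)) ×-dec
      Fin.all? (λ e → ((lookup P e ≟ forward)  →-dec arc? _ _) ×-dec
                      ((lookup P e ≟ backward) →-dec arc? _ _))

  module _ {k} (P : Fin k → OrientedPath) (N : ℕ) where

    private
      class : (Fin N → Fin N → Bool) → Colouring k N → Fin k → Digraph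
      class edge χ i = record { order = N ; Arc = λ u v → T (edge u v) × χ u v ≡ i }

      Avoiding : (Fin N → Fin N → Bool) → Colouring k N → Set
      Avoiding edge χ = Trichotomous _≡_ (λ u v → T (edge u v)) ×
                        ¬ ∃ λ i → Copy (pathDigraph (P i)) (class edge χ i)

      copies? : ∀ edge χ → Dec (∃ λ i → Copy (pathDigraph (P i)) (class edge χ i))
      copies? edge χ = Fin.any? λ i → copy? (P i) {class edge χ i} λ u v → T? (edge u v) ×-dec (χ u v Fin.≟ i)

      avoiding? : ∀ edge → Decidable₁ (Avoiding edge)
      avoiding? edge χ =
        Fin.all? (λ u → Fin.all? λ v → T-tri? (edge u v) (edge v u) (u Fin.≟ v)) ×-dec ¬? (copies? edge χ)

      respects : ∀ {e e′ χ χ′} → Pointwise (Pointwise _≡_) e e′ → Pointwise (Pointwise _≡_) χ χ′ →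
                 Avoiding e χ → Avoiding e′ χ′
      respects e≗ χ≗ (tri , avoids) =
        (λ u v → subst₂ (λ a b → Tri (T a) (u ≡ v) (T b)) (e≗ u v) (e≗ v u) (tri u v)) ,
        λ (i , f , inj , arcs) → avoids (i , f , inj , λ uv → let t , eq = arcs uv in
          subst T (sym (e≗ _ _)) t , trans (χ≗ _ _) eq)

      avoidable? : Dec (∃ λ edge → ∃ (Avoiding edge))
      avoidable? = →-searchable (λ _ → refl) (→-searchable refl Bool-searchable N) N
        (λ e≗ (χ , avoiding) → χ , respects {χ = χ} {χ} e≗ (λ _ _ → refl) avoiding)
        λ edge → →-searchable (λ _ → refl) (→-searchable refl (Fin-searchable k) N) N
          (λ χ≗ → respects {edge} {edge} (λ _ _ → refl) χ≗) (avoiding? edge)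

    -- Needed to pass from some unavoidable order to the least one. The search is for a
    -- counterexample; decidability of copies then turns its absence into an actual copy.
    unavoidable? : Dec (Unavoidable (λ i → pathDigraph (P i)) N)
    unavoidable? = map′
      (λ ¬avoidable 𝒯 χ → decidable-stable (copies? (edge 𝒯) χ)
        λ none → ¬avoidable (edge 𝒯 , χ , tournament 𝒯 , none))
      (λ unavoidable (e , χ , tri , none) → none (unavoidable (record { edge = e ; tournament = tri }) χ))
      (¬? avoidable?)

  least : ∀ {Q : Pred ℕ 0ℓ} → Decidable₁ Q → ∀ n → Q n → ∃ λ m → Q m × m ≤ n × (∀ j → Q j → m ≤ j)
  least {Q} Q? = <-rec _ go
    where
    go : ∀ n → (∀ {m} → m < n → Q m → ∃ λ j → Q j × j ≤ m × (∀ i → Q i → j ≤ i)) →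
         Q n → ∃ λ m → Q m × m ≤ n × (∀ j → Q j → m ≤ j)
    go n rec q with anyUpTo? Q? n
    ... | no none           = n , q , ≤-refl , λ j qj → ≮⇒≥ λ j<n → none (j , j<n , qj)
    ... | yes (m , m<n , qm) with j , qj , j≤m , minimal ← rec m<n qm =
      j , qj , ≤-trans j≤m (<⇒≤ m<n) , minimal

-- The lower bound: a coloured transitive tournament without copies

module LowerBound where

  open import Data.Bool.Base using (T)
  open import Data.Empty using (⊥; ⊥-elim)
  open import Data.Fin.Base as Fin using (Fin; zero; suc; inject₁; toℕ; inject≤; quotient; remainder; combine)
  import Data.Fin.Properties as Fin
  open import Data.List.Base using ([]; _∷_; length; lookup; map; filter; inits; tabulate)
  open import Data.List.Extrema.Nat using (argmax-sel; max≤v⁺)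
  open import Data.List.Membership.Propositional using (_∈_)
  open import Data.List.Membership.Propositional.Properties using (∈-map⁻; ∈-filter⁻; ∈-++⁻)
  open import Data.List.Relation.Unary.Any using (here; there)
  open import Data.List.Relation.Unary.All as All using (All; []; _∷_)
  open import Data.Nat.Base as ℕ using (ℕ; zero; suc; _+_; _*_; _≤_; _<_; s≤s; z≤n)
  open import Data.Nat.ListAction using (product)
  open import Data.Nat.Properties
  open import Data.Product.Base using (∃; _×_; _,_; proj₁; proj₂)
  open import Data.Sum.Base as Sum using (_⊎_; inj₁; inj₂)
  open import Data.Vec.Functional using (updateAt)
  open import Data.Vec.Functional.Properties using (updateAt-updates; updateAt-minimal)
  open import Function.Base using (_∘_; const)
  open import Relation.Binary.Definitions using (Trichotomous; tri<; tri≈; tri>)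
  open import Relation.Binary.PropositionalEquality
  open import Relation.Nullary using (Dec; yes; no; ¬_)
  open import Relation.Nullary.Decidable using (⌊_⌋; toWitness; fromWitness)

  ∈-inits-∷⁻ : ∀ {d} {P Q : OrientedPath} → Q ∈ inits (d ∷ P) → Q ≡ [] ⊎ ∃ λ R → Q ≡ d ∷ R × R ∈ inits P
  ∈-inits-∷⁻ (here refl) = inj₁ refl
  ∈-inits-∷⁻ {d} {P} (there Q∈) with R , R∈ , eq ← ∈-map⁻ (d ∷_) {xs = inits P} Q∈ = inj₂ (R , eq , R∈)

  init-length : ∀ (P : OrientedPath) {Q} → Q ∈ inits P → length Q ≤ length P
  init-length []      (here refl) = z≤n
  init-length (d ∷ P) Q∈ with ∈-inits-∷⁻ Q∈
  ... | inj₁ refl            = z≤n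
  ... | inj₂ (R , refl , R∈) = s≤s (init-length P R∈)

  subpath-length : ∀ P {Q} → Q ∈ subpaths P → length Q ≤ length P
  subpath-length []      (here refl) = z≤n
  subpath-length (d ∷ P) Q∈ with ∈-++⁻ (inits (d ∷ P)) Q∈
  ... | inj₁ Q∈inits = init-length (d ∷ P) Q∈inits
  ... | inj₂ Q∈P     = m≤n⇒m≤1+n (subpath-length P Q∈P)

  l≤L : ∀ P → l P ≤ L P
  l≤L P = max≤v⁺ {xs = map length (filter directed? (subpaths P))} z≤n
    (All.tabulate λ n∈ → bounded n∈)
    where
    bounded : ∀ {n} → n ∈ map length (filter directed? (subpaths P)) → n ≤ L P
    bounded n∈ with Q , Q∈ , refl ← ∈-map⁻ length n∈ =
      subpath-length P (proj₁ (∈-filter⁻ directed? {xs = subpaths P} Q∈))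

  -- A potential that rises along every arc; it will be digit `i` of the block number along a copy
  -- of `P i`.
  Increasing : (P : OrientedPath) → (Fin ∣ P ∣ → ℕ) → Set
  Increasing P w = ∀ e → (lookup P e ≡ forward  → w (inject₁ e) < w (suc e)) ×
                         (lookup P e ≡ backward → w (suc e) < w (inject₁ e))

  increasing-tail : ∀ {d P w} → Increasing (d ∷ P) w → Increasing P (w ∘ suc)
  increasing-tail inc e = inc (suc e)

  -- Each edge gains at least one. The starting value is kept in the claim so that the induction can
  -- pass to the next vertex.
  forward-init : ∀ P {w Q} → Increasing P w → Q ∈ inits P → All (_≡ forward) Q →
                 ∃ λ v → length Q + w zero ≤ w v
  forward-init []      inc (here refl) _ = zero , ≤-refl
  forward-init (d ∷ P) {w} inc Q∈ all with ∈-inits-∷⁻ Q∈ | all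
  ... | inj₁ refl            | _          = zero , ≤-refl
  ... | inj₂ (R , refl , R∈) | refl ∷ all′
    with v , le ← forward-init P {w ∘ suc} (increasing-tail {w = w} inc) R∈ all′ =
    suc v , ≤-trans (≤-reflexive (sym (+-suc (length R) _)))
              (≤-trans (+-monoʳ-≤ (length R) (proj₁ (inc zero) refl)) le)

  backward-init : ∀ P {w Q} → Increasing P w → Q ∈ inits P → All (_≡ backward) Q → length Q ≤ w zero
  backward-init []      inc (here refl) _ = z≤n
  backward-init (d ∷ P) {w} inc Q∈ all with ∈-inits-∷⁻ Q∈ | all
  ... | inj₁ refl            | _          = z≤n
  ... | inj₂ (R , refl , R∈) | refl ∷ all′ =
    ≤-trans (s≤s (backward-init P {w ∘ suc} (increasing-tail {w = w} inc) R∈ all′)) (proj₂ (inc zero) refl)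

  directed-init : ∀ P {w Q} → Increasing P w → Q ∈ inits P → Directed Q → ∃ λ v → length Q ≤ w v
  directed-init P {w} {Q} inc Q∈ (inj₁ all) with v , le ← forward-init P {w} inc Q∈ all =
    v , m+n≤o⇒m≤o (length Q) le
  directed-init P {w} inc Q∈ (inj₂ all) = zero , backward-init P {w} inc Q∈ all

  directed-subpath : ∀ P {w Q} → Increasing P w → Q ∈ subpaths P → Directed Q → ∃ λ v → length Q ≤ w v
  directed-subpath []      inc (here refl) _ = zero , z≤n
  directed-subpath (d ∷ P) {w} inc Q∈ dir with ∈-++⁻ (inits (d ∷ P)) Q∈
  ... | inj₁ Q∈inits = directed-init (d ∷ P) {w} inc Q∈inits dir
  ... | inj₂ Q∈P with v , le ← directed-subpath P {w ∘ suc} (increasing-tail {w = w} inc) Q∈P dir = suc v , le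

  -- The potential gains at least one per edge of a longest directed subpath, so it reaches `l P` at
  -- the end to which the arcs point.
  l≤weight : ∀ P {w} → Increasing P w → ∃ λ v → l P ≤ w v
  l≤weight P {w} inc = Sum.[ (λ l≡0 → zero , ≤-trans (≤-reflexive l≡0) z≤n) , attained ]′
    (argmax-sel (λ n → n) 0 (map length (filter directed? (subpaths P))))
    where
    attained : l P ∈ map length (filter directed? (subpaths P)) → ∃ λ v → l P ≤ w v
    attained l∈ =
      let Q , Q∈ , l≡  = ∈-map⁻ length l∈
          Q∈P , dir    = ∈-filter⁻ directed? {xs = subpaths P} Q∈
          v , le       = directed-subpath P {w} inc Q∈P dir
      in v , ≤-trans (≤-reflexive l≡) le

  -- Mixed-radix expansion, most significant digit first.
  digit : ∀ {k} (m : Fin k → ℕ) → Fin (product (tabulate m)) → ∀ i → Fin (m i)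
  digit {suc k} m x zero    = quotient (product (tabulate (m ∘ suc))) x
  digit {suc k} m x (suc i) = digit (m ∘ suc) (remainder {m zero} (product (tabulate (m ∘ suc))) x) i

  toℕ-remQuot : ∀ {m} n (x : Fin (m * n)) → toℕ x ≡ n * toℕ (quotient {m} n x) + toℕ (remainder {m} n x)
  toℕ-remQuot {m} n x = trans (cong toℕ (sym (Fin.combine-remQuot {m} n x)))
    (Fin.toℕ-combine (quotient {m} n x) (remainder {m} n x))

  -- Used in the contrapositive: from a block to a later one some digit rises, so every edge between
  -- blocks has a colour available.
  digits-≤ : ∀ {k} (m : Fin k → ℕ) {x y} → (∀ i → toℕ (digit m x i) ≤ toℕ (digit m y i)) → toℕ x ≤ toℕ y
  digits-≤ {zero}  m {zero} {zero} _ = z≤n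
  digits-≤ {suc k} m {x} {y} le = begin
    toℕ x  ≡⟨ toℕ-remQuot {m zero} n x ⟩
    n * toℕ (quotient {m zero} n x) + toℕ (remainder {m zero} n x)
           ≤⟨ +-mono-≤ (*-monoʳ-≤ n (le zero)) (digits-≤ (m ∘ suc) (λ i → le (suc i))) ⟩
    n * toℕ (quotient {m zero} n y) + toℕ (remainder {m zero} n y) ≡⟨ toℕ-remQuot {m zero} n y ⟨
    toℕ y  ∎
    where
    open ≤-Reasoning
    n = product (tabulate (m ∘ suc))

  product-updateAt : ∀ {k} (f : Fin k → ℕ) j →
                     product (tabulate (updateAt f j (const 1))) * f j ≡ product (tabulate f)
  product-updateAt f zero    = trans (cong (_* f zero) (*-identityˡ rest)) (*-comm rest (f zero))
    where rest = product (tabulate (f ∘ suc))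
  product-updateAt f (suc j) =
    trans (*-assoc (f zero) _ _) (cong (f zero *_) (product-updateAt (f ∘ suc) j))

  constant : ∀ {A : Set} {n} (f : Fin (suc n) → A) → (∀ e → f (inject₁ e) ≡ f (suc e)) → ∀ v → f v ≡ f zero
  constant f eq zero            = refl
  constant {n = suc n} f eq (suc v) = trans (constant (f ∘ suc) (eq ∘ suc) v) (sym (eq zero))

  lookup-direction : ∀ (P : OrientedPath) e → lookup P e ≡ forward ⊎ lookup P e ≡ backward
  lookup-direction P e with lookup P e
  ... | forward  = inj₁ refl
  ... | backward = inj₂ refl

  -- The blocks {u | u / Lⱼ = b} are monochromatic of colour j, an edge between
  -- two blocks gets the colour of a digit of the block number that increases.
  module Lower {k} (P : Fin k → OrientedPath) (j : Fin k) {blocks} (digits : Fin blocks → Fin k → ℕ)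
               (digits-≤ : ∀ {x y} → (∀ i → digits x i ≤ digits y i) → toℕ x ≤ toℕ y)
               (digitⱼ<1 : ∀ x → digits x j < 1)
               (digit<l : ∀ {i} x → i ≢ j → digits x i < l (P i)) where

    module _ {N} (N≤ : N ≤ blocks * L (P j)) where

      block : Fin N → Fin blocks
      block u = quotient (L (P j)) (inject≤ u N≤)

      offset : Fin N → Fin (L (P j))
      offset u = remainder {blocks} (L (P j)) (inject≤ u N≤)

      block-mono : ∀ {u v} → u Fin.< v → block u Fin.≤ block v
      block-mono {u} {v} u<v = ≮⇒≥ λ v<u → <⇒≱ u<v (<⇒≤ (subst₂ _<_
        (trans (cong toℕ (Fin.combine-remQuot {blocks} (L (P j)) (inject≤ v N≤))) (Fin.toℕ-inject≤ v N≤))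
        (trans (cong toℕ (Fin.combine-remQuot {blocks} (L (P j)) (inject≤ u N≤))) (Fin.toℕ-inject≤ u N≤))
        (Fin.combine-monoˡ-< (offset v) (offset u) v<u)))

      block-offset-injective : ∀ {u v} → block u ≡ block v → offset u ≡ offset v → u ≡ v
      block-offset-injective {u} {v} eqb eqo = Fin.inject≤-injective N≤ N≤ u v (begin
        inject≤ u N≤                   ≡⟨ Fin.combine-remQuot {blocks} (L (P j)) _ ⟨
        combine (block u) (offset u)   ≡⟨ cong₂ combine eqb eqo ⟩
        combine (block v) (offset v)   ≡⟨ Fin.combine-remQuot {blocks} (L (P j)) _ ⟩
        inject≤ v N≤                   ∎)
        where open ≡-Reasoning

      Rises : Fin N → Fin N → Fin k → Set
      Rises u v i = digits (block u) i < digits (block v) i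

      rises? : ∀ u v → Dec (∃ (Rises u v))
      rises? u v = Fin.any? λ i → digits (block u) i <? digits (block v) i

      colour : ∀ {u v} → Dec (∃ (Rises u v)) → Fin k
      colour (yes (i , _)) = i
      colour (no _)        = j

      χ : Colouring k N
      χ u v = colour (rises? u v)

      𝒯 : Tournament N
      𝒯 = record { edge = λ u v → ⌊ u Fin.<? v ⌋ ; tournament = tri }
        where
        tri : Trichotomous _≡_ (λ u v → T ⌊ u Fin.<? v ⌋)
        tri u v with Fin.<-cmp u v
        ... | tri< u<v u≢v v≮u = tri< (fromWitness u<v) u≢v (v≮u ∘ toWitness)
        ... | tri≈ u≮v u≡v v≮u = tri≈ (u≮v ∘ toWitness) u≡v (v≮u ∘ toWitness)
        ... | tri> u≮v u≢v v<u = tri> (u≮v ∘ toWitness) u≢v (fromWitness v<u)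

      Arcᵢ : Fin k → Fin N → Fin N → Set
      Arcᵢ i = Arc (colourClass 𝒯 χ i)

      not-rising⇒same-block : ∀ {u v} → u Fin.< v → ¬ ∃ (Rises u v) → block u ≡ block v
      not-rising⇒same-block u<v ¬rises = Fin.toℕ-injective (≤-antisym (block-mono u<v)
        (digits-≤ λ i → ≮⇒≥ λ lt → ¬rises (i , lt)))

      colourⱼ⇒same-block : ∀ {u v} (r : Dec (∃ (Rises u v))) → u Fin.< v → colour r ≡ j → block u ≡ block v
      colourⱼ⇒same-block         (no ¬rises)       u<v _    = not-rising⇒same-block u<v ¬rises
      -- Digit `j` is always 0, so it cannot be the one that rises.
      colourⱼ⇒same-block {u} {v} (yes (_ , rise)) _   refl =
        ⊥-elim (n≮0 (<-≤-trans rise (ℕ.s≤s⁻¹ (digitⱼ<1 (block v)))))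

      colourᵢ⇒rises : ∀ {u v i} (r : Dec (∃ (Rises u v))) → i ≢ j → colour r ≡ i → Rises u v i
      colourᵢ⇒rises (no _)           i≢j j≡i  = ⊥-elim (i≢j (sym j≡i))
      colourᵢ⇒rises (yes (_ , rise)) _   refl = rise

      arcⱼ⇒same-block : ∀ {u v} → Arcᵢ j u v → block u ≡ block v
      arcⱼ⇒same-block {u} {v} (e , χ≡j) = colourⱼ⇒same-block (rises? u v) (toWitness e) χ≡j

      arcᵢ⇒rises : ∀ {i u v} → i ≢ j → Arcᵢ i u v → Rises u v i
      arcᵢ⇒rises {u = u} {v} i≢j (e , χ≡i) = colourᵢ⇒rises (rises? u v) i≢j χ≡i

      -- The path is connected, so a copy stays inside one block, and a block has only `L (P j)`
      -- offsets for `L (P j) + 1` vertices.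
      no-copyⱼ : ¬ Copy (pathDigraph (P j)) (colourClass 𝒯 χ j)
      no-copyⱼ (f , inj , arcs) = <⇒≱ ≤-refl (Fin.injective⇒≤ {f = offset ∘ f} offset-injective)
        where
        step : ∀ e → block (f (inject₁ e)) ≡ block (f (suc e))
        step e with lookup-direction (P j) e
        ... | inj₁ eq = arcⱼ⇒same-block (arcs (forward e eq))
        ... | inj₂ eq = sym (arcⱼ⇒same-block (arcs (backward e eq)))
        same : ∀ v → block (f v) ≡ block (f zero)
        same = constant (block ∘ f) step
        offset-injective : ∀ {u v} → offset (f u) ≡ offset (f v) → u ≡ v
        offset-injective {u} {v} eq = inj (block-offset-injective (trans (same u) (sym (same v))) eq)

      -- Digit `i` is a potential on the copy, yet it never reaches `l (P i)`.
      no-copyᵢ : ∀ {i} → i ≢ j → ¬ Copy (pathDigraph (P i)) (colourClass 𝒯 χ i)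
      no-copyᵢ {i} i≢j (f , inj , arcs) =
        let v , l≤ = l≤weight (P i) {λ v → digits (block (f v)) i} λ e →
              (λ eq → arcᵢ⇒rises i≢j (arcs (forward e eq))) , (λ eq → arcᵢ⇒rises i≢j (arcs (backward e eq)))
        in <⇒≱ (digit<l (block (f v)) i≢j) l≤

      no-copy : ∀ i → ¬ Copy (pathDigraph (P i)) (colourClass 𝒯 χ i)
      no-copy i copy = decide (i Fin.≟ j)
        where
        decide : Dec (i ≡ j) → ⊥
        decide (yes i≡j) = no-copyⱼ (subst (λ i → Copy (pathDigraph (P i)) (colourClass 𝒯 χ i)) i≡j copy)
        decide (no i≢j)  = no-copyᵢ i≢j copy

      avoidable : ¬ Unavoidable (λ i → pathDigraph (P i)) N
      avoidable unavoidable = let i , copy = unavoidable 𝒯 χ in no-copy i copy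

  module _ {k} (P : Fin k → OrientedPath) (j : Fin k) where

    -- Radix 1 at `j` removes `l (P j)` from the number of blocks and forces digit `j` to be 0,
    -- without reindexing the other colours.
    radix : Fin k → ℕ
    radix = updateAt (λ i → l (P i)) j (const 1)

    lower-bound : ∀ {N} → Unavoidable (λ i → pathDigraph (P i)) N →
                  product (tabulate radix) * L (P j) < N
    lower-bound unavoidable = ≰⇒> λ N≤ → Lower.avoidable P j (λ x i → toℕ (digit radix x i))
      (digits-≤ radix)
      (λ x → ≤-trans (Fin.toℕ<n (digit radix x j)) (≤-reflexive (updateAt-updates j (λ i → l (P i)))))
      (λ {i} x i≢j → ≤-trans (Fin.toℕ<n (digit radix x i)) (≤-reflexive (updateAt-minimal i j (λ i → l (P i)) i≢j)))
      N≤ unavoidable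

-- Passage to rational bounds and conclusion

open UpperBound
open Search
open LowerBound
open import Data.Fin.Base using (zero; suc)
open import Data.Integer.Base as ℤ using (+_)
import Data.Integer.Properties as ℤ
open import Data.List.Base using (foldr; tabulate; allFin; length; map)
open import Data.List.Properties using (length-tabulate; map-tabulate)
open import Data.List.Membership.Propositional.Properties using (∈-allFin)
import Data.List.Relation.Unary.Unique.Propositional.Properties as Unique
open import Data.Nat.Base using (zero; suc; _+_; _*_; s≤s; z≤n; NonZero)
open import Data.Nat.DivMod using (_/_; _%_; m≡m%n+[m/n]*n; m%n<n; m/n*n≤m)
open import Data.Nat.ListAction using (product)
open import Data.Nat.Properties
open import Data.Nat.Tactic.RingSolver using (solve-∀)
open import Data.Product.Base using (_,_)
import Data.Rational.Properties as ℚ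
open import Data.Rational.Unnormalised.Base as ℚᵘ using (mkℚᵘ)
import Data.Rational.Unnormalised.Properties as ℚᵘ
open import Data.Sum.Base using (inj₁; inj₂)
open import Relation.Binary.PropositionalEquality

toℚᵘ-/ : ∀ a b → ℚ.toℚᵘ (+ a ℚ./ suc b) ℚᵘ.≃ mkℚᵘ (+ a) b
toℚᵘ-/ a b = ℚ.toℚᵘ-fromℚᵘ (mkℚᵘ (+ a) b)

/-≤⇒*-≤ : ∀ a b c d .{{_ : NonZero b}} .{{_ : NonZero d}} → + a ℚ./ b ℚ.≤ + c ℚ./ d → a * d ≤ c * b
/-≤⇒*-≤ a (suc b) c (suc d) le
  with ℚᵘ.*≤* le′ ← ℚᵘ.≤-respˡ-≃ (toℚᵘ-/ a b) (ℚᵘ.≤-respʳ-≃ (toℚᵘ-/ c d) (ℚ.toℚᵘ-mono-≤ le)) =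
  ℤ.drop‿+≤+ (subst₂ ℤ._≤_ (sym (ℤ.pos-* a (suc d))) (sym (ℤ.pos-* c (suc b))) le′)

fromℕ-≤ : ∀ {m n} → m ≤ n → fromℕ m ℚ.≤ fromℕ n
fromℕ-≤ {m} {n} m≤n = ℚ.toℚᵘ-cancel-≤ (ℚᵘ.≤-respˡ-≃ (ℚᵘ.≃-sym (toℚᵘ-/ m 0))
  (ℚᵘ.≤-respʳ-≃ (ℚᵘ.≃-sym (toℚᵘ-/ n 0)) (ℚᵘ.*≤* (ℤ.*-monoʳ-≤-nonNeg (+ 1) (ℤ.+≤+ m≤n)))))

fromℕ-*-/ : ∀ m n b .{{_ : NonZero b}} → fromℕ (m * b) ℚ.* (+ n ℚ./ b) ≡ fromℕ (m * n)
fromℕ-*-/ m n (suc b) = ℚ.toℚᵘ-injective (begin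
  ℚ.toℚᵘ (fromℕ (m * suc b) ℚ.* (+ n ℚ./ suc b))            ≈⟨ ℚ.toℚᵘ-homo-* (fromℕ (m * suc b)) (+ n ℚ./ suc b) ⟩
  ℚ.toℚᵘ (fromℕ (m * suc b)) ℚᵘ.* ℚ.toℚᵘ (+ n ℚ./ suc b)    ≈⟨ ℚᵘ.*-cong (toℚᵘ-/ (m * suc b) 0) (toℚᵘ-/ n b) ⟩
  mkℚᵘ (+ (m * suc b)) 0 ℚᵘ.* mkℚᵘ (+ n) b                  ≈⟨ ℚᵘ.*≡* cross ⟩
  mkℚᵘ (+ (m * n)) 0                                        ≈⟨ toℚᵘ-/ (m * n) 0 ⟨
  ℚ.toℚᵘ (fromℕ (m * n))                                    ∎)
  where
  open import Relation.Binary.Reasoning.Setoid ℚᵘ.≃-setoid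
  shuffle : ∀ m b n → m * b * n * 1 ≡ m * n * (1 * b)
  shuffle = solve-∀
  cross : + (m * suc b) ℤ.* + n ℤ.* + 1 ≡ + (m * n) ℤ.* + (1 * suc b)
  cross = trans (cong (ℤ._* + 1) (sym (ℤ.pos-* (m * suc b) n)))
    (trans (sym (ℤ.pos-* (m * suc b * n) 1))
      (trans (cong +_ (shuffle m (suc b) n)) (ℤ.pos-* (m * n) (1 * suc b))))

fromℕ-* : ∀ m n → fromℕ m ℚ.* fromℕ n ≡ fromℕ (m * n)
fromℕ-* m n = trans (cong (λ j → fromℕ j ℚ.* fromℕ n) (sym (*-identityʳ m))) (fromℕ-*-/ m n 1)

0≤/ : ∀ a b .{{_ : NonZero b}} → 0ℚ ℚ.≤ + a ℚ./ b
0≤/ a (suc b) = ℚ.toℚᵘ-cancel-≤ (ℚᵘ.≤-respʳ-≃ (ℚᵘ.≃-sym (toℚᵘ-/ a b))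
  (ℚᵘ.*≤* (subst (+ 0 ℤ.≤_) (sym (ℤ.*-identityʳ (+ a))) (ℤ.+≤+ z≤n))))

-- Nonnegativity lets the initial value 0 of the fold be absorbed by the last entry.
maximum-attained : ∀ {k} (f : Fin (suc k) → ℚ) → (∀ i → 0ℚ ℚ.≤ f i) →
                   ∃ λ j → foldr ℚ._⊔_ 0ℚ (tabulate f) ≡ f j × (∀ i → f i ℚ.≤ f j)
maximum-attained {zero}  f 0≤f = zero , ℚ.p≥q⇒p⊔q≡p (0≤f zero) , λ { zero → ℚ.≤-refl }
maximum-attained {suc k} f 0≤f
  with j , eq , max ← maximum-attained (λ i → f (suc i)) (λ i → 0≤f (suc i))
  with ℚ.≤-total (f zero) (f (suc j))
... | inj₁ le = suc j , trans (cong (f zero ℚ.⊔_) eq) (ℚ.p≤q⇒p⊔q≡q le)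
              , λ { zero → le ; (suc i) → max i }
... | inj₂ ge = zero , trans (cong (f zero ℚ.⊔_) eq) (ℚ.p≥q⇒p⊔q≡p ge)
              , λ { zero → ℚ.≤-refl ; (suc i) → ℚ.≤-trans (max i) ge }

-- The witness is the floor plus one. It overshoots `m` by at most `n`, and `n ≤ m` turns this into
-- the factor 2; for `l` and `L` the condition is `l≤L`.
⌈/⌉ : ∀ m n .{{_ : NonZero n}} → n ≤ m → ∃ λ q → m ≤ q * n × q * n ≤ 2 * m
⌈/⌉ m n n≤m = suc (m / n) ,
  (begin
    m                   ≡⟨ m≡m%n+[m/n]*n m n ⟩
    m % n + m / n * n   ≤⟨ +-monoˡ-≤ _ (<⇒≤ (m%n<n m n)) ⟩
    n + m / n * n       ∎) ,
  (begin
    n + m / n * n       ≤⟨ +-mono-≤ n≤m (m/n*n≤m m n) ⟩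
    m + m               ≡⟨ cong (λ z → m + z) (+-identityʳ m) ⟨
    2 * m               ∎)
  where open ≤-Reasoning

1≤C : ∀ n → 1 ≤ C n
1≤C zero    = s≤s z≤n
1≤C (suc n) = s≤s z≤n

module Bounds {k} (P : Fin k → OrientedPath) (P≥1 : ∀ i → 1 ≤ L (P i)) (j : Fin k)
              (maximal : ∀ i → L (P i) * l (P j) ≤ L (P j) * l (P i)) where

  instance
    lⱼ≢0 : NonZero (l (P j))
    lⱼ≢0 = l-nonZero (P j) (P≥1 j)

  -- `K * L (P j)` is the bound of the theorem with `l (P j)` cancelled, which makes it a natural
  -- number. The 2 in `N₀` pays for rounding the largest ratio.
  K N₀ : ℕ
  K  = product (tabulate (radix P j))
  N₀ = 2 * C k * (K * L (P j))

  product≡ : K * l (P j) ≡ product (tabulate (λ i → l (P i)))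
  product≡ = product-updateAt (λ i → l (P i)) j

  module Upper (D : ℕ) (L≤Dl : L (P j) ≤ D * l (P j)) (Dl≤2L : D * l (P j) ≤ 2 * L (P j)) where

    N₁ : ℕ
    N₁ = C (length (allFin k)) * (D * product (map (λ i → l (P i)) (allFin k)))

    1≤D : 1 ≤ D
    1≤D = n≢0⇒n>0 λ { refl → <⇒≱ (P≥1 j) L≤Dl }

    L≤Dlᵢ : ∀ i → L (P i) ≤ D * l (P i)
    L≤Dlᵢ i = *-cancelʳ-≤ _ _ (l (P j)) (begin
      L (P i) * l (P j)       ≤⟨ maximal i ⟩
      L (P j) * l (P i)       ≤⟨ *-monoˡ-≤ (l (P i)) L≤Dl ⟩
      D * l (P j) * l (P i)   ≡⟨ shuffle D (l (P j)) (l (P i)) ⟩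
      D * l (P i) * l (P j)   ∎)
      where
      open ≤-Reasoning
      shuffle : ∀ a b c → a * b * c ≡ a * c * b
      shuffle = solve-∀

    unavoidable : Unavoidable (λ i → pathDigraph (P i)) N₁
    unavoidable 𝒯 χ = Ramsey.ramsey 𝒯 χ P P≥1 D L≤Dlᵢ 1≤D _ (allFin k) refl
      (Unique.allFin⁺ N₁) (λ _ _ _ → ∈-allFin _) (≤-reflexive (sym (length-tabulate {n = N₁} (λ i → i))))

    N₁≤N₀ : N₁ ≤ N₀
    N₁≤N₀ = begin
      C (length (allFin k)) * (D * product (map (λ i → l (P i)) (allFin k)))
        ≡⟨ cong₂ (λ n ls → C n * (D * product ls)) (length-tabulate {n = k} (λ i → i)) (map-tabulate {n = k} (λ i → i) (λ i → l (P i))) ⟩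
      C k * (D * product (tabulate (λ i → l (P i)))) ≡⟨ cong (λ p → C k * (D * p)) product≡ ⟨
      C k * (D * (K * l (P j)))                      ≡⟨ shuffle (C k) D K (l (P j)) ⟩
      C k * K * (D * l (P j))                        ≤⟨ *-monoʳ-≤ (C k * K) Dl≤2L ⟩
      C k * K * (2 * L (P j))                        ≡⟨ shuffle′ (C k) K (L (P j)) ⟩
      2 * C k * (K * L (P j))                        ∎
      where
      open ≤-Reasoning
      shuffle : ∀ a b c d → a * (b * (c * d)) ≡ a * c * (b * d)
      shuffle = solve-∀
      shuffle′ : ∀ a b c → a * b * (2 * c) ≡ 2 * a * (b * c)
      shuffle′ = solve-∀

  upper-bound : ∃ λ N → Unavoidable (λ i → pathDigraph (P i)) N × N ≤ N₀
  upper-bound = let D , L≤Dl , Dl≤2L = ⌈/⌉ (L (P j)) (l (P j)) (l≤L (P j))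
                in Upper.N₁ D L≤Dl Dl≤2L , Upper.unavoidable D L≤Dl Dl≤2L , Upper.N₁≤N₀ D L≤Dl Dl≤2L

  -- The lower bound holds for every unavoidable order, hence for the least; the upper bound only
  -- has to exhibit one unavoidable order.
  ramsey-number : ∃ λ N → IsRT (λ i → pathDigraph (P i)) N × K * L (P j) ≤ N × N ≤ N₀
  ramsey-number =
    let N₁ , unavoidable , N₁≤N₀ = upper-bound
        N , unavoidableₙ , N≤N₁ , minimal = least (unavoidable? P) N₁ unavoidable
    in N , (unavoidableₙ , minimal) , <⇒≤ (lower-bound P j unavoidableₙ) , ≤-trans N≤N₁ N₁≤N₀

  bound≡ : foldr ℚ._⊔_ 0ℚ (tabulate λ i → ratio (P i) (P≥1 i)) ≡ ratio (P j) (P≥1 j) →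
           bound P P≥1 ≡ fromℕ (K * L (P j))
  bound≡ max≡ = begin
    bound P P≥1                             ≡⟨ cong (fromℕ (product (tabulate (λ i → l (P i)))) ℚ.*_) max≡ ⟩
    fromℕ (product (tabulate (λ i → l (P i)))) ℚ.* ratio (P j) (P≥1 j)
                                            ≡⟨ cong (λ p → fromℕ p ℚ.* ratio (P j) (P≥1 j)) product≡ ⟨
    fromℕ (K * l (P j)) ℚ.* ratio (P j) (P≥1 j) ≡⟨ fromℕ-*-/ K (L (P j)) (l (P j)) ⟩
    fromℕ (K * L (P j))                     ∎
    where open ≡-Reasoning

  ramsey-bounds : ∀ {b} → b ≡ fromℕ (K * L (P j)) →
                  ∃ λ N → IsRT (λ i → pathDigraph (P i)) N ×
                          b ℚ.≤ fromℕ N × fromℕ N ℚ.≤ fromℕ (2 * C k) ℚ.* b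
  ramsey-bounds refl =
    let N , isRT , lower , upper = ramsey-number
    in N , isRT , fromℕ-≤ lower ,
       subst (fromℕ N ℚ.≤_) (sym (fromℕ-* (2 * C k) (K * L (P j)))) (fromℕ-≤ upper)

mainTheorem3 : (k : ℕ) → 1 ≤ k →
    ∃ λ (c : ℚ) → 0ℚ ℚ.< c ×
    ((P : Fin k → OrientedPath) (P≥1 : ∀ i → 1 ≤ L (P i)) →
    ∃ λ (N : ℕ) → IsRT (λ i → pathDigraph (P i)) N ×
    bound P P≥1 ℚ.≤ fromℕ N ×
    fromℕ N ℚ.≤ c ℚ.* bound P P≥1)
mainTheorem3 (suc k) _ = fromℕ (2 * C (suc k)) , positive , λ P P≥1 →
  let j , max≡ , ratio≤ = maximum-attained (λ i → ratio (P i) (P≥1 i))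
        (λ i → 0≤/ (L (P i)) (l (P i)) {{l-nonZero (P i) (P≥1 i)}})
      maximal = λ i → /-≤⇒*-≤ (L (P i)) (l (P i)) (L (P j)) (l (P j))
        {{l-nonZero (P i) (P≥1 i)}} {{l-nonZero (P j) (P≥1 j)}} (ratio≤ i)
  in Bounds.ramsey-bounds P P≥1 j maximal (Bounds.bound≡ P P≥1 j maximal max≡)
  where
  positive : 0ℚ ℚ.< fromℕ (2 * C (suc k))
  positive = ℚ.<-≤-trans (ℚ.positive⁻¹ (fromℕ 1)) (fromℕ-≤ (*-mono-≤ (s≤s {0} {1} z≤n) (1≤C (suc k))))
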